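{- Let $n\ge 1$ be an integer, let $q$ be a prime power, let $\mathcal{C}\subseteq \mathrm{U}(n,\mathbb{F}_q)$ be a linear flag-rank-metric code with minimum distance $\delta=5$, and let $\alpha$ be its codimension. Then $\mathcal{C}$ is perfect if and only if \[ n=\frac{ -(2q^2-q+3)+\sqrt{(2q^2+q+1)^2+8(q^\alpha-q)}}{2(q-1)}. \] Moreover, necessarily $\alpha>\delta$ (that is, $\alpha>5$).
   Context: $\mathbb{F}_q$ is the finite field with $q$ elements. $\mathrm{U}(n,\mathbb{F}_q)$ is the $\mathbb{F}_q$-vector space of $n\times n$ upper triangular matrices over $\mathbb{F}_q$; it has dimension $\frac{n(n+1)}{2}$. For $M\in \mathrm{U}(n,\mathbb{F}_q)$ and $1\le i\le n$, $M_{[i]}$ is the $i\times(n-i+1)$ submatrix of $M$ obtained by deleting the first $i-1$ columns and the last $n-i$ rows (i.e. rows $1,\dots,i$ and columns $i,\dots,n$). The flag-rank weight of $M$ is $\mathrm{fr}(M)=\sum_{i=1}^{n}\mathrm{rk}(M_{[i]})$; the flag-rank distance is $\mathrm{d}_{\mathrm{fr}}(A,B)=\mathrm{fr}(A-B)$. A linear flag-rank-metric code is an $\mathbb{F}_q$-subspace $\mathcal{C}$ of $\mathrm{U}(n,\mathbb{F}_q)$; its minimum (flag-rank) distance, defined when $\mathcal{C}\neq\{\boldsymbol{0}\}$, is $\delta=\min\{\mathrm{fr}(M):M\in\mathcal{C}\setminus\{\boldsymbol{0}\}\}$. Its codimension is $\frac{n(n+1)}{2}-\dim_{\mathbb{F}_q}(\mathcal{C})$.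 Let $b_q(n,t)=|\{A\in \mathrm{U}(n,\mathbb{F}_q):\mathrm{fr}(A)\le t\}|$. A code $\mathcal{C}$ with minimum distance $\delta$ is perfect if $|\mathcal{C}|\,b_q(n,t)=q^{\frac{n(n+1)}{2}}$, where $t=\left\lfloor\frac{\delta-1}{2}\right\rfloor$. -}

module Defs where

open import Algebra.Apartness.Bundles using (HeytingField; HeytingCommutativeRing)
open import Algebra.Apartness.Structures using (IsHeytingField)
open import Algebra.Bundles using (AbelianGroup; Ring; CommutativeRing)
open import Algebra.Core using (Op₁; Op₂)
open import Algebra.Module.Bundles using (LeftModule)
import Algebra.Module.Construct.TensorUnit as TensorUnit
open import Algebra.Module.Core using (Opₗ)
open import Algebra.Module.Structures using (IsLeftModule)
import Algebra.Properties.AbelianGroup as AbelianGroupProperties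
import Algebra.Properties.CommutativeSemigroup as CommutativeSemigroupProperties
open import Data.Fin using (Fin; toℕ; cast; inject≤; _↑ʳ_)
import Data.Fin as Fin
open import Data.Fin.Properties using (any?; toℕ<n; toℕ≤n)
open import Data.Integer using (ℤ)
import Data.Integer as ℤ
open import Data.List using (length)
open import Data.List.Membership.Propositional using (_∈_)
open import Data.List.Relation.Unary.Unique.Propositional using (Unique)
open import Data.Nat using (ℕ; zero; suc; s≤s; z≤n)
import Data.Nat as ℕ
open import Data.Nat.Primality using (Prime; prime⇒nonTrivial; prime⇒nonZero)
import Data.Nat.Properties as ℕ
open import Data.Product using (∃; ∃-syntax; _×_; _,_; proj₁; proj₂)
import Data.Rational as ℚ
import Data.Rational.Properties as ℚ
open import Data.Sum using (_⊎_; inj₁; inj₂)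
open import Data.Vec using (Vec; []; _∷_; foldr′; zipWith; map; replicate; lookup; tabulate; sum)
open import Data.Vec.Properties using (≡-dec; map-cong; map-const; map-id; map-∘; map-replicate;
  zipWith-assoc; zipWith-comm; zipWith-identityˡ; zipWith-identityʳ; zipWith-inverseˡ; zipWith-inverseʳ)
open import Data.Vec.Relation.Unary.All using (All; []; _∷_)
import Data.Vec.Relation.Unary.All as All
open import Function using (_⇔_; mk⇔; _↔_; Equivalence; Inverse; _∘_)
open import Level using (Level; 0ℓ; _⊔_)
open import Relation.Binary.Definitions using (DecidableEquality)
open import Relation.Binary.PropositionalEquality
open import Relation.Nullary using (¬_; Dec; yes; no; contradiction)
import Relation.Nullary.Decidable as Dec
open import Relation.Unary using (Pred; _⊆_; _≐_; Decidable)

private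
  variable
    a ℓ : Level
    k m n : ℕ

IsPrimePower : ℕ → Set
IsPrimePower q = ∃[ p ] ∃[ k ] Prime p × 1 ℕ.≤ k × q ≡ p ℕ.^ k

-- Elements are counted in A, by a repetition-free list; the type Σ A P would
-- also count different proofs of P.
HasCardinality : {A : Set a} → Pred A ℓ → ℕ → Set (a ⊔ ℓ)
HasCardinality {A = A} P k =
  ∃[ xs ] Unique {A = A} xs × (∀ x → x ∈ xs ⇔ P x) × length xs ≡ k

-- A Heyting field whose apartness is ≢: every x ≢ 0# is invertible, and
-- 0# ≢ 1# follows from invertible⇒#.
record FiniteField (q : ℕ) : Set₁ where
  infixl 7 _*_
  infixl 6 _+_
  field
    Carrier        : Set
    _+_ _*_        : Op₂ Carrier
    -_             : Op₁ Carrier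
    0# 1#          : Carrier
    isHeytingField : IsHeytingField _≡_ _≢_ _+_ _*_ -_ 0# 1#
    enumeration    : Fin q ↔ Carrier

  heytingField : HeytingField 0ℓ 0ℓ 0ℓ
  heytingField = record { isHeytingField = isHeytingField }

  open HeytingField heytingField public
    using (heytingCommutativeRing; #⇒invertible)

  ring : Ring 0ℓ 0ℓ
  ring = CommutativeRing.ring (HeytingCommutativeRing.commutativeRing heytingCommutativeRing)

module LinearAlgebra {q : ℕ} (F : FiniteField q) where
  open FiniteField F using (Carrier; 0#; 1#; ring; enumeration)
  private module F = Ring ring

  module _ (V : LeftModule ring 0ℓ 0ℓ) where
    open LeftModule V

    combination : Vec Carrier k → Vec Carrierᴹ k → Carrierᴹ
    combination cs vs = foldr′ _+ᴹ_ 0ᴹ (zipWith _*ₗ_ cs vs)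

    Span : Vec Carrierᴹ k → Pred Carrierᴹ 0ℓ
    Span vs v = ∃[ cs ] v ≈ᴹ combination cs vs

    LinearlyIndependent : Vec Carrierᴹ k → Set
    LinearlyIndependent {k} vs = ∀ cs → combination cs vs ≈ᴹ 0ᴹ → cs ≡ replicate k 0#

    IsBasis : Pred Carrierᴹ ℓ → Vec Carrierᴹ k → Set ℓ
    IsBasis S vs = All S vs × LinearlyIndependent vs × S ⊆ Span vs

    HasDimension : Pred Carrierᴹ ℓ → ℕ → Set ℓ
    HasDimension S k = ∃[ vs ] IsBasis {k = k} S vs

  _≟_ : DecidableEquality Carrier
  x ≟ y = Dec.map′
    (λ eq → trans (sym (strictlyInverseˡ x)) (trans (cong to eq) (strictlyInverseˡ y)))
    (cong from) (from x Fin.≟ from y)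
    where open Inverse enumeration

  any-scalar? : {P : Pred Carrier 0ℓ} → Decidable P → Dec (∃ P)
  any-scalar? {P} P? = Dec.map′
    (λ (i , p) → to i , p)
    (λ (x , p) → from x , subst P (sym (strictlyInverseˡ x)) p)
    (any? (P? ∘ to))
    where open Inverse enumeration

  any-vector? : {P : Pred (Vec Carrier k) 0ℓ} → Decidable P → Dec (∃ P)
  any-vector? {zero}  P? = Dec.map′ (λ p → [] , p) (λ { ([] , p) → p }) (P? [])
  any-vector? {suc k} P? = Dec.map′
    (λ (c , cs , p) → c ∷ cs , p)
    (λ { (c ∷ cs , p) → c , cs , p })
    (any-scalar? λ c → any-vector? λ cs → P? (c ∷ cs))

  module _ (V : LeftModule ring 0ℓ 0ℓ) where
    open LeftModule V
    open AbelianGroupProperties +ᴹ-abelianGroup using (inverseˡ-unique; inverseʳ-unique)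
    open CommutativeSemigroupProperties (AbelianGroup.commutativeSemigroup +ᴹ-abelianGroup)
      using (interchange)
    open import Relation.Binary.Reasoning.Setoid ≈ᴹ-setoid

    combination-zero : (vs : Vec Carrierᴹ k) → combination V (replicate k 0#) vs ≈ᴹ 0ᴹ
    combination-zero []       = ≈ᴹ-refl
    combination-zero (v ∷ vs) =
      ≈ᴹ-trans (+ᴹ-cong (*ₗ-zeroˡ v) (combination-zero vs)) (+ᴹ-identityˡ 0ᴹ)

    combination-+ : ∀ cs ds (vs : Vec Carrierᴹ k) →
      combination V (zipWith F._+_ cs ds) vs ≈ᴹ combination V cs vs +ᴹ combination V ds vs
    combination-+ []       []       []       = ≈ᴹ-sym (+ᴹ-identityˡ 0ᴹ)
    combination-+ (c ∷ cs) (d ∷ ds) (v ∷ vs) = ≈ᴹ-trans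
      (+ᴹ-cong (*ₗ-distribʳ v c d) (combination-+ cs ds vs))
      (interchange _ _ _ _)

    combination-* : ∀ c cs (vs : Vec Carrierᴹ k) →
      combination V (map (c F.*_) cs) vs ≈ᴹ c *ₗ combination V cs vs
    combination-* c []       []       = ≈ᴹ-sym (*ₗ-zeroʳ c)
    combination-* c (d ∷ ds) (v ∷ vs) = ≈ᴹ-trans
      (+ᴹ-cong (*ₗ-assoc c d v) (combination-* c ds vs))
      (≈ᴹ-sym (*ₗ-distribˡ c _ _))

    span-zero : (vs : Vec Carrierᴹ k) → Span V vs 0ᴹ
    span-zero {k} vs = replicate k 0# , ≈ᴹ-sym (combination-zero vs)

    span-cong : (vs : Vec Carrierᴹ k) → ∀ {u v} → u ≈ᴹ v → Span V vs v → Span V vs u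
    span-cong vs u≈v (cs , eq) = cs , ≈ᴹ-trans u≈v eq

    span-+ : (vs : Vec Carrierᴹ k) → ∀ {u v} →
      Span V vs u → Span V vs v → Span V vs (u +ᴹ v)
    span-+ vs (cs , u≈) (ds , v≈) = zipWith F._+_ cs ds ,
      ≈ᴹ-trans (+ᴹ-cong u≈ v≈) (≈ᴹ-sym (combination-+ cs ds vs))

    span-* : (vs : Vec Carrierᴹ k) → ∀ c {v} → Span V vs v → Span V vs (c *ₗ v)
    span-* vs c (cs , v≈) = map (c F.*_) cs ,
      ≈ᴹ-trans (*ₗ-cong refl v≈) (≈ᴹ-sym (combination-* c cs vs))

    span-weaken : ∀ u (vs : Vec Carrierᴹ k) {v} → Span V vs v → Span V (u ∷ vs) v
    span-weaken u vs (cs , v≈) = 0# ∷ cs , ≈ᴹ-trans v≈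
      (≈ᴹ-sym (≈ᴹ-trans (+ᴹ-cong (*ₗ-zeroˡ u) ≈ᴹ-refl) (+ᴹ-identityˡ _)))

    span-head : ∀ u (vs : Vec Carrierᴹ k) → Span V (u ∷ vs) u
    span-head {k} u vs = 1# ∷ replicate k 0# , ≈ᴹ-sym (≈ᴹ-trans
      (+ᴹ-cong (*ₗ-identityˡ u) (combination-zero vs)) (+ᴹ-identityʳ u))

    inverse : ∀ c → c ≢ 0# → ∃[ c⁻¹ ] c⁻¹ F.* c ≡ 1#
    inverse c c≢0 with FiniteField.#⇒invertible F c≢0
    ... | (c⁻¹ , eq , _) = c⁻¹ , trans (cong (c⁻¹ F.*_) (sym c-0≡c)) eq
      where
      c-0≡c : c F.- 0# ≡ c
      c-0≡c = trans (cong (c F.+_) (trans (sym (F.+-identityˡ (F.- 0#))) (F.-‿inverseʳ 0#)))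
                    (F.+-identityʳ c)

    independent-∷ : ∀ u (vs : Vec Carrierᴹ k) → ¬ Span V vs u →
      LinearlyIndependent V vs → LinearlyIndependent V (u ∷ vs)
    independent-∷ u vs u∉ indep (c ∷ cs) eq with c ≟ 0#
    ... | yes refl = cong (0# ∷_) (indep cs (≈ᴹ-trans
            (≈ᴹ-sym (≈ᴹ-trans (+ᴹ-cong (*ₗ-zeroˡ u) ≈ᴹ-refl) (+ᴹ-identityˡ _))) eq))
    ... | no  c≢0  with inverse c c≢0
    ...   | (c⁻¹ , c⁻¹c≡1) = contradiction
            (span-cong vs u≈ (span-* vs c⁻¹ (span-cong vs -w≈ (span-* vs (F.- 1#) (cs , ≈ᴹ-refl))))) u∉
      where
      w = combination V cs vs
      -w≈ : c *ₗ u ≈ᴹ (F.- 1#) *ₗ w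
      -w≈ = begin
        c *ₗ u            ≈⟨ inverseˡ-unique _ _ eq ⟩
        -ᴹ w              ≈⟨ inverseˡ-unique _ _ (begin
          (F.- 1#) *ₗ w +ᴹ w              ≈⟨ +ᴹ-cong ≈ᴹ-refl (*ₗ-identityˡ w) ⟨
          (F.- 1#) *ₗ w +ᴹ 1# *ₗ w        ≈⟨ *ₗ-distribʳ w (F.- 1#) 1# ⟨
          ((F.- 1#) F.+ 1#) *ₗ w          ≈⟨ *ₗ-cong (F.-‿inverseˡ 1#) ≈ᴹ-refl ⟩
          0# *ₗ w                         ≈⟨ *ₗ-zeroˡ w ⟩
          0ᴹ                              ∎) ⟨
        (F.- 1#) *ₗ w     ∎
      u≈ : u ≈ᴹ c⁻¹ *ₗ (c *ₗ u)
      u≈ = begin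
        u                  ≈⟨ *ₗ-identityˡ u ⟨
        1# *ₗ u            ≈⟨ *ₗ-cong c⁻¹c≡1 ≈ᴹ-refl ⟨
        (c⁻¹ F.* c) *ₗ u   ≈⟨ *ₗ-assoc c⁻¹ c u ⟩
        c⁻¹ *ₗ (c *ₗ u)    ∎

    span-hasDimension : (∀ u v → Dec (u ≈ᴹ v)) →
      (vs : Vec Carrierᴹ m) → ∃[ k ] HasDimension V (Span V vs) k
    span-hasDimension _≟ᴹ_ [] = zero , [] , [] , (λ { [] _ → refl }) , λ s → s
    span-hasDimension _≟ᴹ_ (v ∷ vs) with span-hasDimension _≟ᴹ_ vs
    ... | k , bs , bs⊆ , indep , spans
        with any-vector? (λ cs → v ≟ᴹ combination V cs bs)
    ...   | yes v∈ = k , bs , All.map (span-weaken v vs) bs⊆ , indep ,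
              λ { (c ∷ cs , eq) → span-cong bs eq
                    (span-+ bs (span-* bs c v∈) (spans (cs , ≈ᴹ-refl))) }
    ...   | no  v∉ = suc k , v ∷ bs ,
              span-head v vs ∷ All.map (span-weaken v vs) bs⊆ ,
              independent-∷ v bs v∉ indep ,
              λ { (c ∷ cs , eq) → span-cong (v ∷ bs) eq
                    (span-+ (v ∷ bs) (span-* (v ∷ bs) c (span-head v bs))
                      (span-weaken v bs (spans (cs , ≈ᴹ-refl)))) }

  module _ {V : Set} {_+ᴹ_ : Op₂ V} {0ᴹ : V} { -ᴹ_ : Op₁ V} {_*ₗ_ : Opₗ Carrier V} where

    vec-isLeftModule : ∀ n → IsLeftModule ring _≡_ _+ᴹ_ 0ᴹ -ᴹ_ _*ₗ_ →
      IsLeftModule ring (_≡_ {A = Vec V n})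
        (zipWith _+ᴹ_) (replicate n 0ᴹ) (map -ᴹ_) (λ c → map (c *ₗ_))
    vec-isLeftModule n isLeftModule = record
      { isLeftSemimodule = record
        { +ᴹ-isCommutativeMonoid = record
          { isMonoid = record
            { isSemigroup = record
              { isMagma = record { isEquivalence = isEquivalence ; ∙-cong = cong₂ _ }
              ; assoc   = zipWith-assoc +ᴹ-assoc
              }
            ; identity = zipWith-identityˡ +ᴹ-identityˡ , zipWith-identityʳ +ᴹ-identityʳ
            }
          ; comm = zipWith-comm +ᴹ-comm
          }
        ; isPreleftSemimodule = record
          { *ₗ-cong      = cong₂ _
          ; *ₗ-zeroˡ     = λ vs → trans (map-cong *ₗ-zeroˡ vs) (map-const vs 0ᴹ)
          ; *ₗ-distribʳ  = distribʳ
          ; *ₗ-identityˡ = λ vs → trans (map-cong *ₗ-identityˡ vs) (map-id vs)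
          ; *ₗ-assoc     = λ c d vs → trans (map-cong (*ₗ-assoc c d) vs) (map-∘ (c *ₗ_) (d *ₗ_) vs)
          ; *ₗ-zeroʳ     = λ c → trans (map-replicate (c *ₗ_) 0ᴹ n) (cong (replicate n) (*ₗ-zeroʳ c))
          ; *ₗ-distribˡ  = distribˡ
          }
        }
      ; -ᴹ‿cong    = cong _
      ; -ᴹ‿inverse = zipWith-inverseˡ -ᴹ‿inverseˡ , zipWith-inverseʳ -ᴹ‿inverseʳ
      }
      where
      open IsLeftModule isLeftModule

      distribʳ : ∀ {n} (vs : Vec V n) c d →
        map ((c F.+ d) *ₗ_) vs ≡ zipWith _+ᴹ_ (map (c *ₗ_) vs) (map (d *ₗ_) vs)
      distribʳ []       c d = refl
      distribʳ (v ∷ vs) c d = cong₂ _∷_ (*ₗ-distribʳ v c d) (distribʳ vs c d)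

      distribˡ : ∀ {n} c (us vs : Vec V n) →
        map (c *ₗ_) (zipWith _+ᴹ_ us vs) ≡ zipWith _+ᴹ_ (map (c *ₗ_) us) (map (c *ₗ_) vs)
      distribˡ c []       []       = refl
      distribˡ c (u ∷ us) (v ∷ vs) = cong₂ _∷_ (*ₗ-distribˡ c u v) (distribˡ c us vs)

  vectorSpace : ℕ → LeftModule ring 0ℓ 0ℓ
  vectorSpace n = record
    { isLeftModule = vec-isLeftModule n (LeftModule.isLeftModule (TensorUnit.leftModule {R = ring})) }

  Matrix : ℕ → ℕ → Set
  Matrix m n = Vec (Vec Carrier n) m

  matrixSpace : ℕ → ℕ → LeftModule ring 0ℓ 0ℓ
  matrixSpace m n = record
    { isLeftModule = vec-isLeftModule m (LeftModule.isLeftModule (vectorSpace n)) }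

  -- The dimension of the row space.
  rank : Matrix m n → ℕ
  rank {n = n} A = proj₁ (span-hasDimension (vectorSpace n) (≡-dec _≟_) A)

module FlagRank {q : ℕ} (F : FiniteField q) where
  open FiniteField F using (Carrier; 0#)
  open LinearAlgebra F public

  UpperTriangular : Pred (Matrix n n) 0ℓ
  UpperTriangular M = ∀ i j → toℕ j ℕ.< toℕ i → lookup (lookup M i) j ≡ 0#

  -- Indices are 0-based: for i : Fin n this is the matrix M_[i+1], on rows
  -- 0, …, i and columns i, …, n - 1.
  corner : Matrix n n → (i : Fin n) → Matrix (suc (toℕ i)) (n ℕ.∸ toℕ i)
  corner M i = tabulate λ r → tabulate λ c → lookup
    (lookup M (inject≤ r (toℕ<n i)))
    (cast (ℕ.m+[n∸m]≡n (toℕ≤n i)) (toℕ i ↑ʳ c))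

  fr : Matrix n n → ℕ
  fr M = sum (tabulate λ i → rank (corner M i))

  module _ {n : ℕ} where
    open LeftModule (matrixSpace n n)

    record IsLinearCode (C : Pred (Matrix n n) ℓ) : Set ℓ where
      field
        upperTriangular : C ⊆ UpperTriangular
        0ᴹ∈             : C 0ᴹ
        +ᴹ-closed       : ∀ {A B} → C A → C B → C (A +ᴹ B)
        *ₗ-closed       : ∀ c {A} → C A → C (c *ₗ A)

    HasMinimumDistance : Pred (Matrix n n) ℓ → ℕ → Set ℓ
    HasMinimumDistance C δ =
      (∃[ M ] C M × M ≢ 0ᴹ × fr M ≡ δ) × (∀ M → C M → M ≢ 0ᴹ → δ ℕ.≤ fr M)

    HasCodimension : Pred (Matrix n n) ℓ → ℕ → Set ℓ
    HasCodimension C α =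
      ∃[ k ] HasDimension (matrixSpace n n) C k × k ℕ.+ α ≡ n ℕ.* (n ℕ.+ 1) ℕ./ 2

    Ball : ℕ → Pred (Matrix n n) 0ℓ
    Ball t A = UpperTriangular A × fr A ℕ.≤ t

    IsPerfect : Pred (Matrix n n) ℓ → Set ℓ
    IsPerfect C = ∃[ δ ] HasMinimumDistance C δ ×
      (∃[ c ] ∃[ b ] HasCardinality C c × HasCardinality (Ball ((δ ℕ.∸ 1) ℕ./ 2)) b ×
        c ℕ.* b ≡ q ℕ.^ (n ℕ.* (n ℕ.+ 1) ℕ./ 2))

module Real where
  open import Data.Rational hiding (_/_; _÷_; _≃_)
  open import Data.Rational.Properties
  open import Data.Rational.Solver using (module +-*-Solver)

  -- Real numbers as two-sided Dedekind cuts: lower r means r < x and upper r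
  -- means x < r.
  record ℝ : Set₁ where
    field
      lower upper     : Pred ℚ 0ℓ
      lower-inhabited : ∃ lower
      upper-inhabited : ∃ upper
      lower-rounded   : ∀ r → lower r ⇔ (∃[ s ] r < s × lower s)
      upper-rounded   : ∀ s → upper s ⇔ (∃[ r ] r < s × upper r)
      disjoint        : ∀ r → ¬ (lower r × upper r)
      located         : ∀ {r s} → r < s → lower r ⊎ upper s

  infix 4 _≈ℝ_

  _≈ℝ_ : ℝ → ℝ → Set
  x ≈ℝ y = (ℝ.lower x ≐ ℝ.lower y) × (ℝ.upper x ≐ ℝ.upper y)

  q<q+1 : ∀ q → q < q + 1ℚ
  q<q+1 q = subst (_< q + 1ℚ) (+-identityʳ q) (+-monoʳ-< q (positive⁻¹ 1ℚ))

  q-1<q : ∀ q → q - 1ℚ < q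
  q-1<q q = subst (q - 1ℚ <_) (+-identityʳ q) (+-monoʳ-< q (negative⁻¹ (- 1ℚ)))

  q+c-c≡q : ∀ q c → (q + c) - c ≡ q
  q+c-c≡q q c = trans (+-assoc q c (- c))
    (trans (cong (q +_) (+-inverseʳ c)) (+-identityʳ q))

  q-c+c≡q : ∀ q c → (q - c) + c ≡ q
  q-c+c≡q q c = trans (+-assoc q (- c) c)
    (trans (cong (q +_) (+-inverseˡ c)) (+-identityʳ q))

  quotient : ∀ q c → .{{Positive c}} → ∃[ p ] p * c ≡ q
  quotient q c = q * 1/c , trans (*-assoc q 1/c c)
    (trans (cong (q *_) (*-inverseˡ c {{c≢0}})) (*-identityʳ q))
    where
    c≢0 = pos⇒nonZero c
    1/c = (1/ c) {{c≢0}}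

  square-mono-≤ : ∀ {p q} → 0ℚ ≤ p → p ≤ q → p * p ≤ q * q
  square-mono-≤ {p} {q} 0≤p p≤q = ≤-trans
    (*-monoˡ-≤-nonNeg p {{nonNegative 0≤p}} p≤q)
    (*-monoʳ-≤-nonNeg q {{nonNegative (≤-trans 0≤p p≤q)}} p≤q)

  square-mono-< : ∀ {p q} → 0ℚ ≤ p → p < q → p * p < q * q
  square-mono-< {p} {q} 0≤p p<q = ≤-<-trans
    (*-monoˡ-≤-nonNeg p {{nonNegative 0≤p}} (<⇒≤ p<q))
    (*-monoˡ-<-pos q {{positive (≤-<-trans 0≤p p<q)}} p<q)

  0<⇒< : ∀ {p q} → 0ℚ < q - p → p < q
  0<⇒< {p} {q} 0<d = subst₂ _<_ (+-identityˡ p) (q-c+c≡q q p) (+-monoˡ-< p 0<d)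

  <⇒0< : ∀ {p q} → p < q → 0ℚ < q - p
  <⇒0< {p} {q} p<q = subst (_< q - p) (+-inverseʳ p) (+-monoˡ-< (- p) p<q)

  0<* : ∀ {p q} → 0ℚ < p → 0ℚ < q → 0ℚ < p * q
  0<* {p} {q} 0<p 0<q = positive⁻¹ (p * q) {{pos*pos⇒pos p {{positive 0<p}} q {{positive 0<q}}}}

  -- For 0 ≤ r and d ≥ 0, the rational (r (d + 1) + d) / (r + (d + 1)) lies
  -- strictly between r and √ d (on the same side of √ d as r).
  module Approximant (d r : ℚ) (0≤d : 0ℚ ≤ d) (0≤r : 0ℚ ≤ r) where
    K N D : ℚ
    K = d + 1ℚ
    N = r * K + d
    D = r + K

    0<K : 0ℚ < K
    0<K = ≤-<-trans 0≤d (q<q+1 d)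

    0<D : 0ℚ < D
    0<D = +-mono-≤-< 0≤r 0<K

    instance
      D-pos : Positive D
      D-pos = positive 0<D

      D-nonNeg : NonNegative D
      D-nonNeg = pos⇒nonNeg D

      D²-nonNeg : NonNegative (D * D)
      D²-nonNeg = nonNegative (<⇒≤ (0<* 0<D 0<D))

    d<K² : d < K * K
    d<K² = <-≤-trans (q<q+1 d) (subst (_≤ K * K) (*-identityʳ K)
      (*-monoˡ-≤-nonNeg K {{nonNegative (<⇒≤ 0<K)}}
        (subst (_≤ K) (+-identityˡ 1ℚ) (+-monoˡ-≤ 1ℚ 0≤d))))

    s : ℚ
    s = proj₁ (quotient N D)

    sD≡N : s * D ≡ N
    sD≡N = proj₂ (quotient N D)

    s²D²≡N² : (s * s) * (D * D) ≡ N * N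
    s²D²≡N² = trans
      (solve 2 (λ s D → (s :* s) :* (D :* D) := (s :* D) :* (s :* D)) refl s D)
      (cong₂ _*_ sD≡N sD≡N)
      where open +-*-Solver

    linear : N - r * D ≡ d - r * r
    linear = solve 3 (λ r K d → (r :* K :+ d) :- r :* (r :+ K) := d :- r :* r) refl r K d
      where open +-*-Solver

    linear′ : r * D - N ≡ r * r - d
    linear′ = solve 3 (λ r K d → r :* (r :+ K) :- (r :* K :+ d) := r :* r :- d) refl r K d
      where open +-*-Solver

    quadratic : d * (D * D) - N * N ≡ (d - r * r) * (K * K - d)
    quadratic = solve 3 (λ r K d →
      d :* ((r :+ K) :* (r :+ K)) :- (r :* K :+ d) :* (r :* K :+ d)
        := (d :- r :* r) :* (K :* K :- d)) refl r K d
      where open +-*-Solver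

    quadratic′ : N * N - d * (D * D) ≡ (r * r - d) * (K * K - d)
    quadratic′ = solve 3 (λ r K d →
      (r :* K :+ d) :* (r :* K :+ d) :- d :* ((r :+ K) :* (r :+ K))
        := (r :* r :- d) :* (K :* K :- d)) refl r K d
      where open +-*-Solver

    above : r * r < d → r < s × s * s < d
    above r²<d =
      *-cancelʳ-<-nonNeg D (subst (r * D <_) (sym sD≡N)
        (0<⇒< (subst (0ℚ <_) (sym linear) (<⇒0< r²<d)))) ,
      *-cancelʳ-<-nonNeg (D * D) (subst (_< d * (D * D)) (sym s²D²≡N²)
        (0<⇒< (subst (0ℚ <_) (sym quadratic) (0<* (<⇒0< r²<d) (<⇒0< d<K²)))))

    below : d < r * r → s < r × d < s * s
    below d<r² =
      *-cancelʳ-<-nonNeg D (subst (_< r * D) (sym sD≡N)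
        (0<⇒< (subst (0ℚ <_) (sym linear′) (<⇒0< d<r²)))) ,
      *-cancelʳ-<-nonNeg (D * D) (subst (d * (D * D) <_) (sym s²D²≡N²)
        (0<⇒< (subst (0ℚ <_) (sym quadratic′) (0<* (<⇒0< d<r²) (<⇒0< d<K²)))))

    positive-s : 0ℚ < r → 0ℚ < s
    positive-s 0<r = *-cancelʳ-<-nonNeg D
      (subst₂ _<_ (sym (*-zeroˡ D)) (sym sD≡N) (+-mono-<-≤ (0<* 0<r 0<K) 0≤d))

  fromℚ : ℚ → ℝ
  fromℚ c = record
    { lower           = _< c
    ; upper           = c <_
    ; lower-inhabited = c - 1ℚ , q-1<q c
    ; upper-inhabited = c + 1ℚ , q<q+1 c
    ; lower-rounded   = λ r → mk⇔ <-dense (λ (_ , r<s , s<c) → <-trans r<s s<c)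
    ; upper-rounded   = λ s → mk⇔
        (λ c<s → let (r , c<r , r<s) = <-dense c<s in r , r<s , c<r)
        (λ (_ , r<s , c<r) → <-trans c<r r<s)
    ; disjoint        = λ r (r<c , c<r) → <-asym r<c c<r
    ; located         = λ {r} {s} r<s → located r<s (r <? c)
    }
    where
    located : ∀ {r s} → r < s → _ → r < c ⊎ c < s
    located r<s (yes r<c) = inj₁ r<c
    located r<s (no  r≮c) = inj₂ (≤-<-trans (≮⇒≥ r≮c) r<s)

  infixl 6 _+ℝ_
  infixl 7 _÷ℝ_
  infix  8 √_

  _+ℝ_ : ℚ → ℝ → ℝ
  c +ℝ x = record
    { lower           = λ r → lower (r - c)
    ; upper           = λ r → upper (r - c)
    ; lower-inhabited = let (r , l) = lower-inhabited in r + c , back lower l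
    ; upper-inhabited = let (r , u) = upper-inhabited in r + c , back upper u
    ; lower-rounded   = λ r → mk⇔
        (λ l → let (s , r-c<s , l′) = Equivalence.to (lower-rounded (r - c)) l
               in s + c , subst (_< s + c) (q-c+c≡q r c) (+-monoˡ-< c r-c<s) , back lower l′)
        (λ (s , r<s , l) → Equivalence.from (lower-rounded (r - c))
          (s - c , +-monoˡ-< (- c) r<s , l))
    ; upper-rounded   = λ s → mk⇔
        (λ u → let (r , r<s-c , u′) = Equivalence.to (upper-rounded (s - c)) u
               in r + c , subst (r + c <_) (q-c+c≡q s c) (+-monoˡ-< c r<s-c) , back upper u′)
        (λ (r , r<s , u) → Equivalence.from (upper-rounded (s - c))
          (r - c , +-monoˡ-< (- c) r<s , u))
    ; disjoint        = λ r → disjoint (r - c)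
    ; located         = λ r<s → located (+-monoˡ-< (- c) r<s)
    }
    where
    open ℝ x
    back : (P : Pred ℚ 0ℓ) → ∀ {r} → P r → P ((r + c) - c)
    back P {r} = subst P (sym (q+c-c≡q r c))

  _÷ℝ_ : ℝ → (c : ℚ) → .{{Positive c}} → ℝ
  x ÷ℝ c = record
    { lower           = λ r → lower (r * c)
    ; upper           = λ r → upper (r * c)
    ; lower-inhabited = let (r , l) = lower-inhabited ; (p , eq) = quotient r c
                        in p , subst lower (sym eq) l
    ; upper-inhabited = let (r , u) = upper-inhabited ; (p , eq) = quotient r c
                        in p , subst upper (sym eq) u
    ; lower-rounded   = λ r → mk⇔
        (λ l → let (s , rc<s , l′) = Equivalence.to (lower-rounded (r * c)) l
                   (p , eq)        = quotient s c
               in p , *-cancelʳ-<-nonNeg c (subst (r * c <_) (sym eq) rc<s)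
                    , subst lower (sym eq) l′)
        (λ (s , r<s , l) → Equivalence.from (lower-rounded (r * c))
          (s * c , *-monoˡ-<-pos c r<s , l))
    ; upper-rounded   = λ s → mk⇔
        (λ u → let (r , r<sc , u′) = Equivalence.to (upper-rounded (s * c)) u
                   (p , eq)        = quotient r c
               in p , *-cancelʳ-<-nonNeg c (subst (_< s * c) (sym eq) r<sc)
                    , subst upper (sym eq) u′)
        (λ (r , r<s , u) → Equivalence.from (upper-rounded (s * c))
          (r * c , *-monoˡ-<-pos c r<s , u))
    ; disjoint        = λ r → disjoint (r * c)
    ; located         = λ r<s → located (*-monoˡ-<-pos c r<s)
    }
    where
    open ℝ x
    instance
      c-nonNeg : NonNegative c
      c-nonNeg = pos⇒nonNeg c

  -- The non-negative square root; it is 0 for negative d.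
  √_ : ℚ → ℝ
  √ d = record
    { lower           = lower
    ; upper           = upper
    ; lower-inhabited = - 1ℚ , inj₁ (negative⁻¹ (- 1ℚ))
    ; upper-inhabited = above-d
    ; lower-rounded   = λ r → mk⇔ lower-open lower-closed
    ; upper-rounded   = λ s → mk⇔ upper-open upper-closed
    ; disjoint        = λ where
        r (inj₁ r<0  , 0<r , _)    → <-asym r<0 0<r
        r (inj₂ r²<d , _   , d<r²) → <-asym r²<d d<r²
    ; located         = located
    }
    where
    lower upper : Pred ℚ 0ℓ
    lower r = r < 0ℚ ⊎ r * r < d
    upper r = 0ℚ < r × d < r * r

    above-d : ∃ upper
    above-d with d <? 0ℚ
    ... | yes d<0 = 1ℚ , positive⁻¹ 1ℚ , <-trans d<0 (positive⁻¹ (1ℚ * 1ℚ))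
    ... | no  d≮0 = K , 0<K , d<K²
      where open Approximant d 0ℚ (≮⇒≥ d≮0) ≤-refl

    lower-open : ∀ {r} → lower r → ∃[ s ] r < s × lower s
    lower-open (inj₁ r<0) = let (s , r<s , s<0) = <-dense r<0 in s , r<s , inj₁ s<0
    lower-open {r} (inj₂ r²<d) with r <? 0ℚ
    ... | yes r<0 = lower-open (inj₁ r<0)
    ... | no  r≮0 = let (r<s , s²<d) = above r²<d in s , r<s , inj₂ s²<d
      where
      0≤r = ≮⇒≥ r≮0
      open Approximant d r (≤-trans (square-mono-≤ ≤-refl 0≤r) (<⇒≤ r²<d)) 0≤r

    lower-closed : ∀ {r} → ∃[ s ] r < s × lower s → lower r
    lower-closed (_ , r<s , inj₁ s<0) = inj₁ (<-trans r<s s<0)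
    lower-closed {r} (_ , r<s , inj₂ s²<d) with r <? 0ℚ
    ... | yes r<0 = inj₁ r<0
    ... | no  r≮0 = inj₂ (<-trans (square-mono-< (≮⇒≥ r≮0) r<s) s²<d)

    upper-open : ∀ {s} → upper s → ∃[ r ] r < s × upper r
    upper-open {s} (0<s , d<s²) with d <? 0ℚ
    ... | yes d<0 = let (r , 0<r , r<s) = <-dense 0<s
                    in r , r<s , 0<r , <-trans d<0 (0<* 0<r 0<r)
    ... | no  d≮0 = let (r<s , d<r²) = A.below d<s²
                    in A.s , r<s , A.positive-s 0<s , d<r²
      where module A = Approximant d s (≮⇒≥ d≮0) (<⇒≤ 0<s)

    upper-closed : ∀ {s} → ∃[ r ] r < s × upper r → upper s
    upper-closed (_ , r<s , 0<r , d<r²) =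
      <-trans 0<r r<s , <-trans d<r² (square-mono-< (<⇒≤ 0<r) r<s)

    located : ∀ {r s} → r < s → lower r ⊎ upper s
    located {r} {s} r<s with r <? 0ℚ | r * r <? d
    ... | yes r<0 | _        = inj₁ (inj₁ r<0)
    ... | no  _   | yes r²<d = inj₁ (inj₂ r²<d)
    ... | no  r≮0 | no  r²≮d = inj₂
      ( ≤-<-trans (≮⇒≥ r≮0) r<s
      , ≤-<-trans (≮⇒≥ r²≮d) (square-mono-< (≮⇒≥ r≮0) r<s))

fromℤ : ℤ → ℚ.ℚ
fromℤ z = z ℚ./ 1

2[q-1]-positive : ∀ {q} → IsPrimePower q → ℚ.Positive (fromℤ (ℤ.+ 2 ℤ.* (ℤ.+ q ℤ.- ℤ.+ 1)))
2[q-1]-positive {q} (p , k , p-prime , 1≤k , refl) = positive (ℕ.≤-trans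
  (ℕ.nonTrivial⇒n>1 p {{prime⇒nonTrivial p-prime}})
  (subst (ℕ._≤ p ℕ.^ k) (ℕ.*-identityʳ p) (ℕ.^-monoʳ-≤ p {{prime⇒nonZero p-prime}} 1≤k)))
  where
  positive : ∀ {q} → 1 ℕ.< q → ℚ.Positive (fromℤ (ℤ.+ 2 ℤ.* (ℤ.+ q ℤ.- ℤ.+ 1)))
  positive (s≤s (s≤s {n = j} z≤n)) = ℚ.normalize-pos (2 ℕ.* suc j) 1

{-# OPTIONS --safe #-}
module Submission where

-- The weight of an upper triangular matrix can be computed by peeling off the
-- first row and column. This classifies the matrices of weight at most 2 (at
-- most two non-zero diagonal entries and nothing else, or one 2 × 2 diagonal
-- block with a non-zero off-diagonal entry), so the ball of radius 2 has size
--   b = 1 + n (q - 1) + n (n - 1) / 2 (q - 1)² + (n - 1) (q - 1) q².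
-- Since |C| = q ^ (n (n + 1) / 2 - α), perfection means b = q ^ α, which is a
-- quadratic equation for n whose positive root is the formula.
--
-- For α > 5: distance 5 forces n ≥ 3, and the upper triangular matrices
-- supported on the leading 3 × 3 block form a 6-dimensional space of matrices
-- of weight at most 4, which therefore meets C only in 0.

open import Defs
open import Algebra.Bundles using (AbelianGroup; Ring)
open import Algebra.Module.Bundles using (LeftModule)
import Algebra.Properties.AbelianGroup as AbelianGroupProperties
import Algebra.Properties.CommutativeSemigroup as CommutativeSemigroupProperties
open import Data.Fin using (Fin; zero; suc; toℕ; cast; inject≤; _↑ʳ_)
import Data.Fin as Fin
open import Data.Fin.Properties using (cast-is-id; punchIn-injective; punchIn-punchOut;
  punchInᵢ≢i; toℕ<n; toℕ≤n; toℕ-cast; toℕ-↑ʳ)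
import Data.Integer as ℤ
import Data.Integer.Properties as ℤ
import Data.Integer.Tactic.RingSolver as ℤ-Solver
open import Data.Nat using (ℕ; zero; suc; z≤n; s≤s)
import Data.Nat as ℕ
open import Data.Nat.DivMod using (m*n/n≡m)
open import Data.Nat.Primality using (prime⇒nonTrivial; prime⇒nonZero)
import Data.Nat.Properties as ℕ
import Data.Nat.Tactic.RingSolver as ℕ-Solver
open import Data.Product using (∃-syntax; _×_; _,_; proj₁; proj₂)
open import Data.Sum using (_⊎_; inj₁; inj₂)
open import Data.Vec.Properties using (≡-dec; ∷-injective; lookup-map; lookup-replicate;
  lookup-zipWith; map-replicate; tabulate-cong; tabulate∘lookup)
open import Data.Vec.Relation.Unary.All using (All; []; _∷_)
import Data.Vec.Relation.Unary.All as All
import Data.Vec.Relation.Unary.All.Properties as All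
open import Function using (_⇔_; mk⇔; Equivalence; _∘_; _↔_; Inverse)
import Function.Properties.Equivalence as ⇔
open import Level using (Level; 0ℓ)
open import Relation.Binary.Definitions using (tri<; tri≈; tri>)
open import Relation.Binary.PropositionalEquality
open import Relation.Nullary using (¬_; yes; no; contradiction)
open import Relation.Unary using (Pred; _⊆_; _≐_; U)
open Real using (fromℚ; _≈ℝ_; _+ℝ_; _÷ℝ_; √_)

private
  variable
    a b ℓ : Level
    j k m n : ℕ

-- Counting by repetition-free lists.

module Cardinality where
  open import Data.List using (List; []; _∷_; _++_; length; map; cartesianProduct; allFin)
  open import Data.List.Properties using (length-++; length-map; length-tabulate)
  open import Data.List.Membership.Propositional using (_∈_)
  open import Data.List.Membership.Propositional.Properties using
    (∈-∃++; ∈-++⁻; ∈-++⁺ˡ; ∈-++⁺ʳ; ∈-map⁺; ∈-map⁻; ∈-cartesianProduct⁺; ∈-cartesianProduct⁻; ∈-allFin)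
  open import Data.List.Relation.Binary.Subset.Propositional using () renaming (_⊆_ to _⊆ₗ_)
  import Data.List.Relation.Unary.All as ListAll
  import Data.List.Relation.Unary.AllPairs as AllPairs
  open import Data.List.Relation.Unary.Any using (here; there)
  open import Data.List.Relation.Unary.Unique.Propositional using (Unique)
  import Data.List.Relation.Unary.Unique.Propositional.Properties as Unique
  open import Data.Nat using (_+_; _*_; _≤_)

  private
    variable
      A B : Set a
      P Q : Pred A ℓ

  -- Pigeonhole: splitting `ys` at an occurrence of `x` and removing it leaves a list that still
  -- contains `xs`, because `x` does not recur in `xs`.
  unique-⊆⇒length-≤ : {xs ys : List A} → Unique xs → xs ⊆ₗ ys → length xs ≤ length ys
  unique-⊆⇒length-≤ {xs = []}     _                 _     = z≤n
  unique-⊆⇒length-≤ {xs = x ∷ xs} (x∉xs AllPairs.∷ xs!) xs⊆ys with ∈-∃++ (xs⊆ys (here refl))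
  ... | as , bs , refl = subst (suc (length xs) ≤_)
          (sym (trans (length-++ as) (trans (ℕ.+-suc (length as) _) (cong suc (sym (length-++ as))))))
          (s≤s (unique-⊆⇒length-≤ xs! λ y∈xs → skip y∈xs (∈-++⁻ as (xs⊆ys (there y∈xs)))))
    where
    skip : ∀ {y} → y ∈ xs → y ∈ as ⊎ y ∈ x ∷ bs → y ∈ as ++ bs
    skip y∈xs (inj₁ y∈as)         = ∈-++⁺ˡ y∈as
    skip y∈xs (inj₂ (here refl))  = contradiction refl (ListAll.lookup x∉xs y∈xs)
    skip y∈xs (inj₂ (there y∈bs)) = ∈-++⁺ʳ as y∈bs

  card-mono : P ⊆ Q → HasCardinality P j → HasCardinality Q k → j ≤ k
  card-mono P⊆Q (xs , xs! , xs≐ , refl) (ys , _ , ys≐ , refl) = unique-⊆⇒length-≤ xs! λ {x} x∈xs →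
    Equivalence.from (ys≐ x) (P⊆Q (Equivalence.to (xs≐ x) x∈xs))

  -- Lets the cardinalities supplied by `IsPerfect` be replaced by the computed ones.
  card-unique : {P : Pred A ℓ} → HasCardinality P j → HasCardinality P k → j ≡ k
  card-unique {P = P} card-j card-k = ℕ.≤-antisym
    (card-mono {P = P} {Q = P} (λ x → x) card-j card-k)
    (card-mono {P = P} {Q = P} (λ x → x) card-k card-j)

  card-cong : P ≐ Q → HasCardinality P k → HasCardinality Q k
  card-cong (P⊆Q , Q⊆P) (xs , xs! , xs≐ , eq) = xs , xs! ,
    (λ x → mk⇔ (P⊆Q ∘ Equivalence.to (xs≐ x)) (Equivalence.from (xs≐ x) ∘ Q⊆P)) , eq

  Image : {A : Set a} {B : Set b} → (A → B) → Pred A ℓ → Pred B _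
  Image f P y = ∃[ x ] P x × y ≡ f x

  card-image : (f : A → B) → (∀ {x y} → f x ≡ f y → x ≡ y) →
    HasCardinality P k → HasCardinality (Image f P) k
  card-image f f-injective (xs , xs! , xs≐ , refl) =
    map f xs , Unique.map⁺ f-injective xs! ,
    (λ y → mk⇔
      (λ y∈ → let (x , x∈xs , eq) = ∈-map⁻ f y∈ in x , Equivalence.to (xs≐ x) x∈xs , eq)
      (λ { (x , px , refl) → ∈-map⁺ f (Equivalence.from (xs≐ x) px) })) ,
    length-map f xs

  length-cartesianProduct : (xs : List A) (ys : List B) →
    length (cartesianProduct xs ys) ≡ length xs * length ys
  length-cartesianProduct []       ys = refl
  length-cartesianProduct (x ∷ xs) ys = trans (length-++ (map (x ,_) ys))
    (cong₂ _+_ (length-map (x ,_) ys) (length-cartesianProduct xs ys))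

  card-× : HasCardinality P j → HasCardinality Q k →
    HasCardinality (λ (x , y) → P x × Q y) (j * k)
  card-× (xs , xs! , xs≐ , refl) (ys , ys! , ys≐ , refl) =
    cartesianProduct xs ys , Unique.cartesianProduct⁺ xs! ys! ,
    (λ (x , y) → mk⇔
      (λ xy∈ → let (x∈ , y∈) = ∈-cartesianProduct⁻ xs ys xy∈
               in Equivalence.to (xs≐ x) x∈ , Equivalence.to (ys≐ y) y∈)
      (λ (px , qy) → ∈-cartesianProduct⁺ (Equivalence.from (xs≐ x) px) (Equivalence.from (ys≐ y) qy))) ,
    length-cartesianProduct xs ys

  card-⊎ : (∀ {x} → P x → ¬ Q x) → HasCardinality P j → HasCardinality Q k →
    HasCardinality (λ x → P x ⊎ Q x) (j + k)
  card-⊎ disjoint (xs , xs! , xs≐ , refl) (ys , ys! , ys≐ , refl) =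
    xs ++ ys ,
    Unique.++⁺ xs! ys! (λ (x∈ , y∈) → disjoint (Equivalence.to (xs≐ _) x∈) (Equivalence.to (ys≐ _) y∈)) ,
    (λ x → mk⇔
      (λ x∈ → classify (∈-++⁻ xs x∈))
      (λ { (inj₁ px) → ∈-++⁺ˡ (Equivalence.from (xs≐ x) px)
         ; (inj₂ qx) → ∈-++⁺ʳ xs (Equivalence.from (ys≐ x) qx) })) ,
    length-++ xs
    where
    classify : ∀ {x} → x ∈ xs ⊎ x ∈ ys → _ ⊎ _
    classify (inj₁ x∈) = inj₁ (Equivalence.to (xs≐ _) x∈)
    classify (inj₂ x∈) = inj₂ (Equivalence.to (ys≐ _) x∈)

  card-singleton : (x : A) → HasCardinality (_≡ x) 1
  card-singleton x = x ∷ [] , ListAll.[] AllPairs.∷ AllPairs.[] ,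
    (λ y → mk⇔ (λ { (here eq) → eq ; (there ()) }) here) , refl

  card-Fin : ∀ k → HasCardinality {A = Fin k} U k
  card-Fin k = allFin k , Unique.allFin⁺ k , (λ i → mk⇔ _ (λ _ → ∈-allFin i)) , length-tabulate (λ i → i)

  card-↔ : Fin k ↔ A → HasCardinality {A = A} U k
  card-↔ i = card-cong (_ , λ {y} _ → from y , _ , sym (strictlyInverseˡ y))
    (card-image to to-injective (card-Fin _))
    where
    open Inverse i
    to-injective : ∀ {x y} → to x ≡ to y → x ≡ y
    to-injective {x} {y} eq =
      trans (sym (strictlyInverseʳ x)) (trans (cong from eq) (strictlyInverseʳ y))

  -- `punchIn` at the index of `x` runs through all other indices, so composing it with the
  -- enumeration lists every element except `x`.
  card-≢ : Fin (suc k) ↔ A → (x : A) → HasCardinality (_≢ x) k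
  card-≢ i x = card-cong
    ( (λ { (j , _ , refl) eq → punchInᵢ≢i (from x) j
             (trans (sym (strictlyInverseʳ _)) (cong from eq)) })
    , λ {y} y≢x → let fx≢fy = λ eq → y≢x (trans (sym (strictlyInverseˡ y))
                                   (trans (cong to (sym eq)) (strictlyInverseˡ x)))
        in Fin.punchOut fx≢fy , _ ,
           sym (trans (cong to (punchIn-punchOut fx≢fy)) (strictlyInverseˡ y)))
    (card-image (to ∘ Fin.punchIn (from x))
      (λ eq → punchIn-injective (from x) _ _
        (trans (sym (strictlyInverseʳ _)) (trans (cong from eq) (strictlyInverseʳ _))))
      (card-Fin _))
    where open Inverse i

open Cardinality

-- Sums and tabulations of vectors.

module Vectors where
  open import Data.Nat using (_≤_)
  open import Data.Vec using (Vec; []; _∷_; map; replicate; sum; tabulate)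

  sum-tabulate-mono : {f g : Fin n → ℕ} → (∀ i → f i ≤ g i) → sum (tabulate f) ≤ sum (tabulate g)
  sum-tabulate-mono {zero}  f≤g = z≤n
  sum-tabulate-mono {suc n} f≤g = ℕ.+-mono-≤ (f≤g zero) (sum-tabulate-mono (f≤g ∘ suc))

  sum-tabulate-zero : {f : Fin n → ℕ} → (∀ i → f i ≤ 0) → sum (tabulate f) ≤ 0
  sum-tabulate-zero {zero}  f≤0 = z≤n
  sum-tabulate-zero {suc n} f≤0 = ℕ.+-mono-≤ (f≤0 zero) (sum-tabulate-zero (f≤0 ∘ suc))

  tabulate-const : {A : Set} {f : Fin n → A} {x : A} → (∀ i → f i ≡ x) → tabulate f ≡ replicate n x
  tabulate-const {zero}  f≡x = refl
  tabulate-const {suc n} f≡x = cong₂ _∷_ (f≡x zero) (tabulate-const (f≡x ∘ suc))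

  map-injective : {A B : Set} {f : A → B} → (∀ {x y} → f x ≡ f y → x ≡ y) →
    {xs ys : Vec A n} → map f xs ≡ map f ys → xs ≡ ys
  map-injective f-injective {[]}     {[]}     _  = refl
  map-injective f-injective {x ∷ xs} {y ∷ ys} eq =
    let (fx≡fy , eqs) = ∷-injective eq in cong₂ _∷_ (f-injective fx≡fy) (map-injective f-injective eqs)

open Vectors

-- Numerical identities: ball size, discriminant, triangular numbers.

module BallSize where
  open import Data.Nat using (_+_; _*_; _^_; _≤_; _<_)

  -- Used to read off inequalities of dimensions from inequalities of cardinalities.
  ^-cancelʳ-≤ : ∀ {q j k} → 1 < q → q ^ j ≤ q ^ k → j ≤ k
  ^-cancelʳ-≤ {q} 1<q q^j≤q^k = ℕ.≮⇒≥ λ k<j → ℕ.<⇒≱ (ℕ.^-monoʳ-< q 1<q k<j) q^j≤q^k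

  -- The size of the ball of radius 2 for matrices of size n + 1 and q = p + 1.
  -- Adding a row and a column contributes the matrices with non-zero corner
  -- entry over a ball of radius 1, and those with off-diagonal entries.
  ball₂ : ℕ → ℕ → ℕ
  ball₂ p zero    = 1 + p * 1
  ball₂ p (suc n) = (ball₂ p n + p * (1 + suc n * p)) + suc p * (suc p * p)

  -- Doubling clears the denominator of (n + 1) n / 2 in the closed form, so the induction becomes
  -- polynomial identities.
  2*ball₂ : ∀ p n → 2 * ball₂ p n ≡
    2 + 2 * (suc n * p) + suc n * n * (p * p) + 2 * (n * (p * (suc p * suc p)))
  2*ball₂ p zero    = base p
    where
    base : ∀ p → 2 * (1 + p * 1) ≡ 2 + 2 * (1 * p) + 1 * 0 * (p * p) + 2 * (0 * (p * (suc p * suc p)))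
    base = ℕ-Solver.solve-∀
  2*ball₂ p (suc n) = trans (regroup (ball₂ p n) p n) (trans
    (cong (_+ (2 * (p * (1 + suc n * p)) + 2 * (suc p * (suc p * p)))) (2*ball₂ p n))
    (step p n))
    where
    regroup : ∀ b p n → 2 * ((b + p * (1 + suc n * p)) + suc p * (suc p * p)) ≡
      2 * b + (2 * (p * (1 + suc n * p)) + 2 * (suc p * (suc p * p)))
    regroup = ℕ-Solver.solve-∀
    step : ∀ p n →
      2 + 2 * (suc n * p) + suc n * n * (p * p) + 2 * (n * (p * (suc p * suc p))) +
        (2 * (p * (1 + suc n * p)) + 2 * (suc p * (suc p * p))) ≡
      2 + 2 * (suc (suc n) * p) + suc (suc n) * suc n * (p * p) + 2 * (suc n * (p * (suc p * suc p)))
    step = ℕ-Solver.solve-∀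

  -- The value n e - c that the square root must take when n = (c + √ d) / e, with
  -- c = -(2 q² - q + 3), e = 2 (q - 1) and q = p + 1.
  root : ℕ → ℕ → ℕ
  root n p = n * (2 * p) + (2 * (p * p) + (3 * p + 4))

  offset : ℕ → ℕ
  offset q = 2 * (q * q) + (q + 1)

  -- With d = offset² + 8 (q ^ α - q), both sides moved so that no subtraction
  -- occurs: root² = d says exactly that ball₂ p n = q ^ α.
  root² : ∀ p n → root (suc n) p * root (suc n) p + 8 * suc p ≡
    offset (suc p) * offset (suc p) + 8 * ball₂ p n
  root² p n = trans (expand p n) (trans
    (cong (λ t → offset (suc p) * offset (suc p) + 4 * t) (sym (2*ball₂ p n)))
    (cong (offset (suc p) * offset (suc p) +_) (sym (ℕ.*-assoc 4 2 (ball₂ p n)))))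
    where
    expand : ∀ p n →
      (suc n * (2 * p) + (2 * (p * p) + (3 * p + 4))) *
      (suc n * (2 * p) + (2 * (p * p) + (3 * p + 4))) + 8 * suc p ≡
      (2 * (suc p * suc p) + (suc p + 1)) * (2 * (suc p * suc p) + (suc p + 1)) +
      4 * (2 + 2 * (suc n * p) + suc n * n * (p * p) + 2 * (n * (p * (suc p * suc p))))
    expand = ℕ-Solver.solve-∀

  -- The recursion adds a first row of length n + 1, which is how upper triangular matrices are
  -- counted below.
  triangle : ℕ → ℕ
  triangle zero    = 0
  triangle (suc n) = suc n + triangle n

  triangle≡ : ∀ n → triangle n ≡ n * (n + 1) ℕ./ 2
  triangle≡ n = sym (trans (cong (ℕ._/ 2) (sym (double n))) (m*n/n≡m (triangle n) 2))
    where
    regroup : ∀ n t → (suc n + t) * 2 ≡ 2 * suc n + t * 2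
    regroup = ℕ-Solver.solve-∀
    step : ∀ n → 2 * suc n + n * (n + 1) ≡ suc n * (suc n + 1)
    step = ℕ-Solver.solve-∀
    double : ∀ n → triangle n * 2 ≡ n * (n + 1)
    double zero    = refl
    double (suc n) = trans (regroup n (triangle n))
      (trans (cong (2 * suc n +_) (double n)) (step n))

open BallSize

-- Linear independence and rank bounds over a finite field.

module Rank {q : ℕ} (1<q : 1 ℕ.< q) (F : FiniteField q) where
  open import Data.Nat using (_^_; _≤_)
  open import Data.Vec using (Vec; []; _∷_; map; replicate)
  open FiniteField F using (Carrier; 0#; 1#; ring; enumeration)
  private module F = Ring ring
  open LinearAlgebra F

  module _ (V : LeftModule ring 0ℓ 0ℓ) where
    open LeftModule V
    open AbelianGroupProperties +ᴹ-abelianGroup using (inverseˡ-unique; ⁻¹-involutive)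
    open import Relation.Binary.Reasoning.Setoid ≈ᴹ-setoid

    -- Differences are formed with the scalar -1 because closure of a linear code is stated for sums
    -- and scalar multiples.
    -1*ₗ : ∀ v → (F.- 1#) *ₗ v ≈ᴹ -ᴹ v
    -1*ₗ v = inverseˡ-unique _ _ (begin
      (F.- 1#) *ₗ v +ᴹ v             ≈⟨ +ᴹ-cong ≈ᴹ-refl (*ₗ-identityˡ v) ⟨
      (F.- 1#) *ₗ v +ᴹ 1# *ₗ v       ≈⟨ *ₗ-distribʳ v (F.- 1#) 1# ⟨
      ((F.- 1#) F.+ 1#) *ₗ v         ≈⟨ *ₗ-cong (F.-‿inverseˡ 1#) ≈ᴹ-refl ⟩
      0# *ₗ v                        ≈⟨ *ₗ-zeroˡ v ⟩
      0ᴹ                             ∎)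

    difference-zero : ∀ {u v} → u +ᴹ (F.- 1#) *ₗ v ≈ᴹ 0ᴹ → u ≈ᴹ v
    difference-zero {u} {v} eq = begin
      u                      ≈⟨ inverseˡ-unique _ _ eq ⟩
      -ᴹ ((F.- 1#) *ₗ v)     ≈⟨ -ᴹ‿cong (-1*ₗ v) ⟩
      -ᴹ (-ᴹ v)              ≈⟨ ⁻¹-involutive v ⟩
      v                      ∎

    -- Separates two subspaces: if `u` and `v` lie in one and `x` and `y` in another, the common
    -- value of the two sides lies in both.
    difference-swap : ∀ {u v x y} → u +ᴹ x ≈ᴹ v +ᴹ y →
      u +ᴹ (F.- 1#) *ₗ v ≈ᴹ y +ᴹ (F.- 1#) *ₗ x
    difference-swap {u} {v} {x} {y} eq = begin
      u +ᴹ (F.- 1#) *ₗ v             ≈⟨ +ᴹ-cong ≈ᴹ-refl (-1*ₗ v) ⟩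
      u +ᴹ -ᴹ v                      ≈⟨ +ᴹ-identityʳ _ ⟨
      (u +ᴹ -ᴹ v) +ᴹ 0ᴹ              ≈⟨ +ᴹ-cong ≈ᴹ-refl (-ᴹ‿inverseʳ x) ⟨
      (u +ᴹ -ᴹ v) +ᴹ (x +ᴹ -ᴹ x)     ≈⟨ interchange _ _ _ _ ⟩
      (u +ᴹ x) +ᴹ (-ᴹ v +ᴹ -ᴹ x)     ≈⟨ +ᴹ-cong eq ≈ᴹ-refl ⟩
      (v +ᴹ y) +ᴹ (-ᴹ v +ᴹ -ᴹ x)     ≈⟨ interchange _ _ _ _ ⟩
      (v +ᴹ -ᴹ v) +ᴹ (y +ᴹ -ᴹ x)     ≈⟨ +ᴹ-cong (-ᴹ‿inverseʳ v) (+ᴹ-cong ≈ᴹ-refl (≈ᴹ-sym (-1*ₗ x))) ⟩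
      0ᴹ +ᴹ (y +ᴹ (F.- 1#) *ₗ x)     ≈⟨ +ᴹ-identityˡ _ ⟩
      y +ᴹ (F.- 1#) *ₗ x             ∎
      where
      open CommutativeSemigroupProperties (AbelianGroup.commutativeSemigroup +ᴹ-abelianGroup)
        using (interchange)

  module _ (V : LeftModule ring 0ℓ 0ℓ) where
    open LeftModule V

    -- Independence kills the difference of the two coefficient vectors; a basis thus gives
    -- coordinates, and with them a count.
    combination-injective : {vs : Vec Carrierᴹ k} → LinearlyIndependent V vs →
      ∀ {cs ds} → combination V cs vs ≈ᴹ combination V ds vs → cs ≡ ds
    combination-injective {k} {vs} independent {cs} {ds} eq =
      difference-zero (vectorSpace k) (independent _
        (≈ᴹ-trans (combination-+ V cs _ vs)
        (≈ᴹ-trans (+ᴹ-cong eq (combination-* V (F.- 1#) ds vs))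
        (≈ᴹ-trans (+ᴹ-cong ≈ᴹ-refl (-1*ₗ V _)) (-ᴹ‿inverseʳ _)))))

    span-combination : {us : Vec Carrierᴹ m} {vs : Vec Carrierᴹ k} →
      All (Span V vs) us → ∀ cs → Span V vs (combination V cs us)
    span-combination {vs = vs} []         []       = span-zero V vs
    span-combination {vs = vs} (u∈ ∷ us∈) (c ∷ cs) =
      span-+ V vs (span-* V vs c u∈) (span-combination us∈ cs)

    span-trans : {us : Vec Carrierᴹ m} {vs : Vec Carrierᴹ k} →
      All (Span V vs) us → ∀ {w} → Span V us w → Span V vs w
    span-trans {vs = vs} us∈ (cs , eq) = span-cong V vs eq (span-combination us∈ cs)

    span-self : (vs : Vec Carrierᴹ k) → All (Span V vs) vs
    span-self []       = []
    span-self (v ∷ vs) = span-head V v vs ∷ All.map (span-weaken V v vs) (span-self vs)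

  card-vectors : ∀ k → HasCardinality {A = Vec Carrier k} U (q ^ k)
  card-vectors zero    = card-cong (_ , λ { {[]} _ → refl }) (card-singleton [])
  card-vectors (suc k) = card-cong (_ , λ { {c ∷ cs} _ → (c , cs) , _ , refl })
    (card-image (λ (c , cs) → c ∷ cs) (λ eq → cong₂ _,_ (proj₁ (∷-injective eq)) (proj₂ (∷-injective eq)))
      (card-× (card-↔ enumeration) (card-vectors k)))

  -- The coordinate map from q ^ m coefficient vectors to q ^ k is injective.
  independent⊆span⇒≤ : (V : LeftModule ring 0ℓ 0ℓ) → let open LeftModule V in
    {us : Vec Carrierᴹ m} {vs : Vec Carrierᴹ k} →
    LinearlyIndependent V us → All (Span V vs) us → m ≤ k
  independent⊆span⇒≤ {m} {k} V {us} {vs} independent us∈ = ^-cancelʳ-≤ 1<q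
    (card-mono _ (card-image coordinates coordinates-injective (card-vectors m)) (card-vectors k))
    where
    open LeftModule V
    coordinates : Vec Carrier m → Vec Carrier k
    coordinates cs = proj₁ (span-combination V us∈ cs)

    coordinates-injective : ∀ {cs ds} → coordinates cs ≡ coordinates ds → cs ≡ ds
    coordinates-injective {cs} {ds} eq = combination-injective V independent
      (≈ᴹ-trans (proj₂ (span-combination V us∈ cs))
      (≈ᴹ-trans (≈ᴹ-reflexive (cong (λ es → combination V es vs) eq))
                (≈ᴹ-sym (proj₂ (span-combination V us∈ ds)))))

  row-basis : (A : Matrix m n) → HasDimension (vectorSpace n) (Span (vectorSpace n) A) (rank A)
  row-basis A = proj₂ (span-hasDimension (vectorSpace _) (≡-dec _≟_) A)

  -- Sealed, because type checking would otherwise unfold the Gaussian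
  -- elimination behind rank.
  opaque
    rowRank : Matrix m n → ℕ
    rowRank = rank

    rowRank≡rank : (A : Matrix m n) → rowRank A ≡ rank A
    rowRank≡rank A = refl

    -- Lower bounds come from exhibiting independent vectors, upper bounds (`rowRank-≤`) from
    -- exhibiting generators; both compare with the chosen basis of the row space.
    rowRank-≥ : (us : Vec (Vec Carrier n) k) (A : Matrix m n) →
      LinearlyIndependent (vectorSpace n) us → All (Span (vectorSpace n) A) us → k ≤ rowRank A
    rowRank-≥ us A independent us∈ with row-basis A
    ... | _ , _ , _ , spans = independent⊆span⇒≤ (vectorSpace _) independent (All.map spans us∈)

    rowRank-≤ : (vs : Vec (Vec Carrier n) k) (A : Matrix m n) →
      All (Span (vectorSpace n) vs) A → rowRank A ≤ k
    rowRank-≤ vs A A∈ with row-basis A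
    ... | _ , bs∈ , independent , _ =
      independent⊆span⇒≤ (vectorSpace _) independent (All.map (span-trans (vectorSpace _) A∈) bs∈)

    rowRank-mono : (A : Matrix m n) (B : Matrix k n) → All (Span (vectorSpace n) B) A → rowRank A ≤ rowRank B
    rowRank-mono A B A∈ with row-basis B
    ... | _ , _ , _ , spans = rowRank-≤ _ A (All.map spans A∈)

  rowRank≤rows : (A : Matrix m n) → rowRank A ≤ m
  rowRank≤rows A = rowRank-≤ A A (span-self (vectorSpace _) A)

  rowRank-zero : (A : Matrix m n) → All (_≡ replicate n 0#) A → rowRank A ≤ 0
  rowRank-zero A A≡0 = rowRank-≤ [] A (All.map (λ eq → [] , eq) A≡0)

  rowRank-≤-∷ : (v : Vec Carrier n) (A : Matrix m n) → rowRank A ≤ rowRank (v ∷ A)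
  rowRank-≤-∷ v A = rowRank-mono A (v ∷ A)
    (All.map (span-weaken (vectorSpace _) v A) (span-self (vectorSpace _) A))

  rowRank-0∷ : (A : Matrix m n) → rowRank (replicate n 0# ∷ A) ≡ rowRank A
  rowRank-0∷ A = ℕ.≤-antisym
    (rowRank-mono _ A (span-zero (vectorSpace _) A ∷ span-self (vectorSpace _) A))
    (rowRank-≤-∷ _ A)

  singleton-independent : {v : Vec Carrier n} → v ≢ replicate n 0# →
    LinearlyIndependent (vectorSpace n) (v ∷ [])
  singleton-independent v≢0 = independent-∷ (vectorSpace _) _ [] (λ { ([] , eq) → v≢0 eq }) λ { [] _ → refl }

  rowRank-∷-≥1 : (v : Vec Carrier n) (A : Matrix m n) → v ≢ replicate n 0# → 1 ≤ rowRank (v ∷ A)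
  rowRank-∷-≥1 v A v≢0 = rowRank-≥ (v ∷ []) (v ∷ A)
    (singleton-independent v≢0) (span-head (vectorSpace _) v A ∷ [])

  -- Rows whose only possible non-zero entry is the first lie on one line, so a corner made of such
  -- rows has rank at most 1.
  span-unit : ∀ x → Span (vectorSpace (suc n)) ((1# ∷ replicate n 0#) ∷ []) (x ∷ replicate n 0#)
  span-unit {n} x = x ∷ [] , sym (trans
    (LeftModule.+ᴹ-identityʳ (vectorSpace (suc n)) _)
    (cong₂ _∷_ (F.*-identityʳ x) (LeftModule.*ₗ-zeroʳ (vectorSpace n) x)))

  -- The multiples of the first row have zero tail, so the second row, with tail `w`, is not among
  -- them.
  rowRank-≥2 : ∀ b c (w : Vec Carrier n) → b ≢ 0# → w ≢ replicate n 0# →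
    2 ≤ rowRank ((b ∷ replicate n 0#) ∷ (c ∷ w) ∷ [])
  rowRank-≥2 {n} b c w b≢0 w≢0 = rowRank-≥
    -- The rows are swapped because `independent-∷` asks for the head to lie outside the span of the
    -- rest.
    ((c ∷ w) ∷ (b ∷ replicate n 0#) ∷ []) ((b ∷ replicate n 0#) ∷ (c ∷ w) ∷ [])
    (independent-∷ (vectorSpace _) _ _ c∷w∉ (singleton-independent (b≢0 ∘ proj₁ ∘ ∷-injective)))
    (span-weaken V _ _ (span-head V (c ∷ w) []) ∷ span-head V _ ((c ∷ w) ∷ []) ∷ [])
    where
    V = vectorSpace (suc n)
    c∷w∉ : ¬ Span V ((b ∷ replicate n 0#) ∷ []) (c ∷ w)
    c∷w∉ (d ∷ [] , eq) = w≢0 (trans (proj₂ (∷-injective eq))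
      (trans (LeftModule.+ᴹ-identityʳ (vectorSpace n) _) (LeftModule.*ₗ-zeroʳ (vectorSpace n) d)))

-- Flag-rank weight when a first row and column are added.

module FlagRankWeight {q : ℕ} (1<q : 1 ℕ.< q) (F : FiniteField q) where
  open import Data.Nat using (_+_; _∸_; _≤_)
  open import Data.Vec using (Vec; []; _∷_; head; lookup; map; replicate; sum; tabulate; tail)
  open FiniteField F using (Carrier; 0#; 1#; ring; enumeration)
  open FlagRank F
  open Rank 1<q F

  0ᵛ : Vec Carrier n
  0ᵛ = replicate _ 0#

  0ᴹ : Matrix m n
  0ᴹ = replicate _ 0ᵛ

  -- Every upper triangular matrix of positive size has this form in exactly one way, which drives
  -- the inductions on the size.
  extend : Carrier → Vec Carrier n → Matrix n n → Matrix (suc n) (suc n)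
  extend a v M = (a ∷ v) ∷ map (0# ∷_) M

  extend-injective : ∀ {a b} {v w : Vec Carrier n} {M N} →
    extend a v M ≡ extend b w N → a ≡ b × v ≡ w × M ≡ N
  extend-injective eq =
    let (row≡ , rows≡) = ∷-injective eq ; (a≡b , v≡w) = ∷-injective row≡
    in a≡b , v≡w , map-injective (proj₂ ∘ ∷-injective) rows≡

  extend-0ᴹ : extend 0# 0ᵛ (0ᴹ {n} {n}) ≡ 0ᴹ
  extend-0ᴹ {n} = cong (0ᵛ ∷_) (map-replicate (0# ∷_) 0ᵛ n)

  extend-upperTriangular : ∀ a (v : Vec Carrier n) {M} → UpperTriangular M → UpperTriangular (extend a v M)
  extend-upperTriangular a v {M} M-UT (suc i) zero    _         =
    cong (λ row → lookup row zero) (lookup-map i (0# ∷_) M)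
  extend-upperTriangular a v {M} M-UT (suc i) (suc j) (s≤s j<i) =
    trans (cong (λ row → lookup row (suc j)) (lookup-map i (0# ∷_) M)) (M-UT i j j<i)

  0ᴹ-upperTriangular : UpperTriangular (0ᴹ {n} {n})
  0ᴹ-upperTriangular i j _ =
    trans (cong (λ row → lookup row j) (lookup-replicate i 0ᵛ)) (lookup-replicate j 0#)

  columns-below-0 : (M : Matrix m (suc n)) → (∀ i → lookup (lookup M i) zero ≡ 0#) →
    M ≡ map (0# ∷_) (map tail M)
  columns-below-0 []            _    = refl
  columns-below-0 ((x ∷ v) ∷ M) zeros =
    cong₂ _∷_ (cong (_∷ v) (zeros zero)) (columns-below-0 M (zeros ∘ suc))

  upperTriangular⇒extend : (M : Matrix (suc n) (suc n)) → UpperTriangular M →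
    ∃[ a ] ∃[ v ] ∃[ N ] UpperTriangular N × M ≡ extend a v N
  upperTriangular⇒extend ((a ∷ v) ∷ M) M-UT = a , v , map tail M ,
    (λ i j j<i → trans (cong (λ row → lookup row j) (lookup-map i tail M))
      (trans (lookup-tail (lookup M i) j) (M-UT (suc i) (suc j) (s≤s j<i)))) ,
    cong ((a ∷ v) ∷_) (columns-below-0 M (λ i → M-UT (suc i) zero (s≤s z≤n)))
    where
    lookup-tail : (w : Vec Carrier (suc n)) (j : Fin n) → lookup (tail w) j ≡ lookup w (suc j)
    lookup-tail (x ∷ w) j = refl

  -- The index expression copies the one in `corner`, so each row of `corner M i` is definitionally
  -- a suffix of a row of `M`.
  suffix : (i : Fin n) → Vec Carrier n → Vec Carrier (n ∸ toℕ i)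
  suffix i v = tabulate λ c → lookup v (cast (ℕ.m+[n∸m]≡n (toℕ≤n i)) (toℕ i ↑ʳ c))

  suffix-zero : (v : Vec Carrier (suc n)) → suffix zero v ≡ v
  suffix-zero v = trans (tabulate-cong λ c → cong (lookup v) (cast-is-id refl c)) (tabulate∘lookup v)

  suffix-0ᵛ : (i : Fin n) → suffix i 0ᵛ ≡ 0ᵛ
  suffix-0ᵛ i = tabulate-const λ c → lookup-replicate (cast (ℕ.m+[n∸m]≡n (toℕ≤n i)) (toℕ i ↑ʳ c)) 0#

  corner-zero : (M : Matrix (suc n) (suc n)) → corner M zero ≡ head M ∷ []
  corner-zero (v ∷ M) = cong (_∷ []) (suffix-zero v)

  -- Moving past the first column discards the zeros put there by `extend`.
  corner-extend-suc : ∀ a (v : Vec Carrier n) M i →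
    corner (extend a v M) (suc i) ≡ suffix i v ∷ corner M i
  corner-extend-suc a v M i = cong (suffix i v ∷_) (tabulate-cong λ r →
    cong (suffix (suc i)) (lookup-map (inject≤ r (toℕ<n i)) (0# ∷_) M))

  flagRank : Matrix n n → ℕ
  flagRank M = sum (tabulate λ i → rowRank (corner M i))

  fr≡flagRank : (M : Matrix n n) → fr M ≡ flagRank M
  fr≡flagRank M = cong sum (tabulate-cong λ i → sym (rowRank≡rank (corner M i)))

  flagRank-extend : ∀ a (v : Vec Carrier n) M →
    flagRank (extend a v M) ≡ rowRank ((a ∷ v) ∷ []) + sum (tabulate λ i → rowRank (suffix i v ∷ corner M i))
  flagRank-extend a v M = cong₂ _+_ (cong rowRank (corner-zero (extend a v M)))
    (cong sum (tabulate-cong λ i → cong rowRank (corner-extend-suc a v M i)))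

  flagRank-extend-0ᵛ : ∀ a (M : Matrix n n) → flagRank (extend a 0ᵛ M) ≡ rowRank ((a ∷ 0ᵛ) ∷ []) + flagRank M
  flagRank-extend-0ᵛ a M = trans (flagRank-extend a 0ᵛ M)
    (cong (rowRank ((a ∷ 0ᵛ) ∷ []) +_) (cong sum (tabulate-cong λ i →
    trans (cong (λ v → rowRank (v ∷ corner M i)) (suffix-0ᵛ i)) (rowRank-0∷ (corner M i)))))

  flagRank-extend-≥ : ∀ a (v : Vec Carrier n) M →
    rowRank ((a ∷ v) ∷ []) + flagRank M ≤ flagRank (extend a v M)
  flagRank-extend-≥ a v M = subst (rowRank ((a ∷ v) ∷ []) + flagRank M ≤_) (sym (flagRank-extend a v M))
    (ℕ.+-monoʳ-≤ (rowRank ((a ∷ v) ∷ [])) (sum-tabulate-mono λ i → rowRank-≤-∷ (suffix i v) (corner M i)))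

  -- The summand at index 0 suffices, its suffix being all of `v`. The rows below are arbitrary, so
  -- the bound applies after one peeling or two.
  sum-suffix-≥1 : {rows : Fin n → ℕ} (v : Vec Carrier n) (A : ∀ i → Matrix (rows i) (n ∸ toℕ i)) →
    v ≢ 0ᵛ → 1 ≤ sum (tabulate λ i → rowRank (suffix i v ∷ A i))
  sum-suffix-≥1 {zero}  []       A v≢0 = contradiction refl v≢0
  sum-suffix-≥1 {suc n} v        A v≢0 = ℕ.≤-trans
    (rowRank-∷-≥1 (suffix zero v) (A zero) (subst (_≢ 0ᵛ) (sym (suffix-zero v)) v≢0))
    (ℕ.m≤m+n _ _)

  rowRank-row-0 : rowRank ((0# ∷ 0ᵛ {n}) ∷ []) ≡ 0
  rowRank-row-0 {n} = ℕ.n≤0⇒n≡0 (rowRank-zero _ (refl ∷ []))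

  rowRank-row-≢0 : (v : Vec Carrier n) → v ≢ 0ᵛ → rowRank (v ∷ []) ≡ 1
  rowRank-row-≢0 v v≢0 = ℕ.≤-antisym (rowRank≤rows (v ∷ [])) (rowRank-∷-≥1 v [] v≢0)

  flagRank-0ᴹ : ∀ n → flagRank (0ᴹ {n} {n}) ≡ 0
  flagRank-0ᴹ zero    = refl
  flagRank-0ᴹ (suc n) = trans (cong flagRank (sym (extend-0ᴹ {n})))
    (trans (flagRank-extend-0ᵛ 0# 0ᴹ) (cong₂ _+_ (rowRank-row-0 {n}) (flagRank-0ᴹ n)))

  -- A non-zero first row gives the first corner rank 1; otherwise induction applies to the smaller
  -- matrix.
  flagRank-≤0⇒≡0ᴹ : (M : Matrix n n) → UpperTriangular M → flagRank M ≤ 0 → M ≡ 0ᴹ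
  flagRank-≤0⇒≡0ᴹ {zero}  []  _    _    = refl
  flagRank-≤0⇒≡0ᴹ {suc n} M M-UT flagRank≤0 with upperTriangular⇒extend M M-UT
  ... | a , v , N , N-UT , refl with ≡-dec _≟_ (a ∷ v) 0ᵛ
  ...   | yes refl = trans (cong (extend 0# 0ᵛ) (flagRank-≤0⇒≡0ᴹ N N-UT
            (ℕ.≤-trans (ℕ.m≤n+m (flagRank N) _) (ℕ.≤-trans (flagRank-extend-≥ a v N) flagRank≤0)))) extend-0ᴹ
  ...   | no  av≢0 = contradiction
            (ℕ.≤-trans (rowRank-∷-≥1 (a ∷ v) [] av≢0)
              (ℕ.≤-trans (ℕ.m≤m+n _ (flagRank N)) (ℕ.≤-trans (flagRank-extend-≥ a v N) flagRank≤0)))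
            λ ()

  -- A non-zero `v` counts twice: inside the row of the first corner and as the top row of the
  -- second.
  flagRank-extend-≥2 : ∀ a (v : Vec Carrier n) M → v ≢ 0ᵛ → 2 ≤ flagRank (extend a v M)
  flagRank-extend-≥2 a v M v≢0 = subst (2 ≤_) (sym (flagRank-extend a v M)) (ℕ.+-mono-≤
    (rowRank-∷-≥1 (a ∷ v) [] (v≢0 ∘ proj₂ ∘ ∷-injective)) (sum-suffix-≥1 v (corner M) v≢0))

  flagRank-extend² : ∀ a b c (v w : Vec Carrier n) M →
    flagRank (extend a (b ∷ v) (extend c w M)) ≡
    rowRank ((a ∷ b ∷ v) ∷ []) + (rowRank ((b ∷ v) ∷ (c ∷ w) ∷ []) +
      sum (tabulate λ i → rowRank (suffix i v ∷ suffix i w ∷ corner M i)))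
  flagRank-extend² a b c v w M = trans (flagRank-extend a (b ∷ v) (extend c w M))
    (cong (rowRank ((a ∷ b ∷ v) ∷ []) +_) (cong₂ _+_
      (cong₂ (λ u A → rowRank (u ∷ A)) (suffix-zero (b ∷ v)) (corner-zero (extend c w M)))
      (cong sum (tabulate-cong λ i → cong (λ A → rowRank (suffix i v ∷ A)) (corner-extend-suc c w M i)))))

  -- The first corner is a single row, the second has entries only in its first column, and the
  -- later ones vanish: 1 + 1 + 0.
  flagRank-off-diagonal : ∀ a b c → b ≢ 0# → flagRank (extend a (b ∷ 0ᵛ {n}) (extend c 0ᵛ 0ᴹ)) ≤ 2
  flagRank-off-diagonal {n} a b c b≢0 = subst (_≤ 2) (sym (flagRank-extend² a b c 0ᵛ 0ᵛ 0ᴹ)) (ℕ.+-mono-≤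
    (rowRank≤rows ((a ∷ b ∷ 0ᵛ {n}) ∷ []))
    (ℕ.+-mono-≤
      (rowRank-≤ ((1# ∷ 0ᵛ) ∷ []) ((b ∷ 0ᵛ) ∷ (c ∷ 0ᵛ) ∷ []) (span-unit b ∷ span-unit c ∷ []))
      (sum-tabulate-zero {n} λ i → rowRank-zero (suffix i 0ᵛ ∷ suffix i 0ᵛ ∷ corner 0ᴹ i)
        (suffix-0ᵛ i ∷ suffix-0ᵛ i ∷ All.tabulate⁺ λ r →
          trans (cong (suffix i) (lookup-replicate (inject≤ r (toℕ<n i)) 0ᵛ)) (suffix-0ᵛ i)))))

  -- The first two corners have rank at least 1 each, which uses up the weight 2. A non-zero `v`
  -- would add rank in a later corner, a non-zero `w` would raise the second corner to rank 2.
  flagRank-≤2⇒off-diagonal : ∀ a b c (v w : Vec Carrier n) M → b ∷ v ≢ 0ᵛ → UpperTriangular M →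
    flagRank (extend a (b ∷ v) (extend c w M)) ≤ 2 → v ≡ 0ᵛ × b ≢ 0# × w ≡ 0ᵛ × M ≡ 0ᴹ
  flagRank-≤2⇒off-diagonal {n} a b c v w M bv≢0 M-UT flagRank≤2 = v≡0 , b≢0 , w≡0 ,
    -- Each later corner contains the rows of a corner of `M`, so no weight remains for `M`.
    flagRank-≤0⇒≡0ᴹ M M-UT (ℕ.+-cancelˡ-≤ 2 (flagRank M) 0 (ℕ.≤-trans (ℕ.+-monoʳ-≤ 1 (ℕ.+-monoʳ-≤ 1
      (sum-tabulate-mono λ i →
        ℕ.≤-trans (rowRank-≤-∷ (suffix i w) (corner M i)) (rowRank-≤-∷ (suffix i v) _))))
      (bound top≥1 (rowRank-∷-≥1 (b ∷ v) ((c ∷ w) ∷ []) bv≢0) ℕ.≤-refl)))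
    where
    bound : ∀ {x y z} → x ≤ rowRank ((a ∷ b ∷ v) ∷ []) → y ≤ rowRank ((b ∷ v) ∷ (c ∷ w) ∷ []) →
      z ≤ sum (tabulate λ i → rowRank (suffix i v ∷ suffix i w ∷ corner M i)) → x + (y + z) ≤ 2
    bound x≤ y≤ z≤ = ℕ.≤-trans (ℕ.+-mono-≤ x≤ (ℕ.+-mono-≤ y≤ z≤))
      (subst (_≤ 2) (flagRank-extend² a b c v w M) flagRank≤2)

    top≥1 = rowRank-∷-≥1 (a ∷ b ∷ v) [] (bv≢0 ∘ proj₂ ∘ ∷-injective)

    v≡0 : v ≡ 0ᵛ
    v≡0 with ≡-dec _≟_ v 0ᵛ
    ... | yes v≡0 = v≡0
    ... | no  v≢0 = contradiction
      (bound top≥1 (rowRank-∷-≥1 (b ∷ v) ((c ∷ w) ∷ []) bv≢0)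
        (sum-suffix-≥1 v (λ i → suffix i w ∷ corner M i) v≢0))
      λ { (s≤s (s≤s ())) }

    b≢0 : b ≢ 0#
    b≢0 b≡0 = bv≢0 (cong₂ _∷_ b≡0 v≡0)

    w≡0 : w ≡ 0ᵛ
    w≡0 with ≡-dec _≟_ w 0ᵛ
    ... | yes w≡0 = w≡0
    -- Ranks 1 and 2 already exceed the bound, so `z = 0` drops the later corners.
    ... | no  w≢0 = contradiction
      (bound {z = 0} top≥1
        (subst (λ u → 2 ≤ rowRank ((b ∷ u) ∷ (c ∷ w) ∷ [])) (sym v≡0) (rowRank-≥2 b c w b≢0 w≢0)) z≤n)
      λ { (s≤s (s≤s ())) }

-- Sizes of the balls of radius 0, 1 and 2.

module Balls {p : ℕ} (1<q : 1 ℕ.< suc p) (F : FiniteField (suc p)) where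
  open import Data.Nat using (_+_; _*_; _^_; _≤_)
  open import Data.Vec using ([]; _∷_)
  open FiniteField F using (Carrier; 0#; enumeration)
  open FlagRank F
  open Rank 1<q F
  open FlagRankWeight 1<q F

  card-upperTriangular : ∀ n → HasCardinality (UpperTriangular {n}) (suc p ^ triangle n)
  card-upperTriangular zero    = card-cong ((λ _ ()) , λ { {[]} _ → refl }) (card-singleton [])
  card-upperTriangular (suc n) = subst (HasCardinality UpperTriangular)
    (cong (suc p *_) (sym (ℕ.^-distribˡ-+-* (suc p) n (triangle n))))
    (card-cong
      ( (λ { (_ , (_ , _ , N-UT) , refl) → extend-upperTriangular _ _ N-UT })
      , λ {M} M-UT → let (a , v , N , N-UT , eq) = upperTriangular⇒extend M M-UT
                     in (a , v , N) , (_ , _ , N-UT) , eq)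
      (card-image (λ (a , v , N) → extend a v N)
        (λ eq → let (a≡ , v≡ , N≡) = extend-injective eq in cong₂ _,_ a≡ (cong₂ _,_ v≡ N≡))
        (card-× (card-↔ enumeration) (card-× (card-vectors n) (card-upperTriangular n)))))

  FlagBall : ℕ → Pred (Matrix n n) 0ℓ
  FlagBall t M = UpperTriangular M × flagRank M ≤ t

  extendDiagonal : Carrier × Matrix n n → Matrix (suc n) (suc n)
  extendDiagonal (a , N) = extend a 0ᵛ N

  -- The part of a ball whose first row is zero off the diagonal: a zero corner entry costs nothing,
  -- a non-zero one costs exactly 1 and lowers the remaining radius.
  DiagonalStep : ℕ → Pred (Matrix (suc n) (suc n)) 0ℓ
  DiagonalStep {n} t M =
    Image (extend 0# 0ᵛ) (FlagBall {n} (suc t)) M ⊎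
    Image extendDiagonal (λ (a , N) → a ≢ 0# × FlagBall {n} t N) M

  diagonalStep⊆ball : ∀ {t} → DiagonalStep {n} t ⊆ FlagBall (suc t)
  diagonalStep⊆ball {n} {t} (inj₁ (N , (N-UT , N≤) , refl)) = extend-upperTriangular 0# 0ᵛ N-UT ,
    subst (_≤ suc t) (sym (trans (flagRank-extend-0ᵛ 0# N) (cong (_+ flagRank N) (rowRank-row-0 {n})))) N≤
  diagonalStep⊆ball {n} {t} (inj₂ ((a , N) , (_ , N-UT , N≤) , refl)) = extend-upperTriangular a 0ᵛ N-UT ,
    subst (_≤ suc t) (sym (flagRank-extend-0ᵛ a N)) (ℕ.+-mono-≤ (rowRank≤rows ((a ∷ 0ᵛ) ∷ [])) N≤)

  ball⊆diagonalStep : ∀ {t} a (N : Matrix n n) → UpperTriangular N → flagRank (extend a 0ᵛ N) ≤ suc t →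
    DiagonalStep t (extend a 0ᵛ N)
  ball⊆diagonalStep {n} {t} a N N-UT fr≤ with a ≟ 0#
  ... | yes refl = inj₁ (N , (N-UT ,
          ℕ.≤-trans (ℕ.m≤n+m (flagRank N) _) (ℕ.≤-trans (flagRank-extend-≥ 0# 0ᵛ N) fr≤)) , refl)
  ... | no  a≢0  = inj₂ ((a , N) , (a≢0 , N-UT , ℕ.+-cancelˡ-≤ 1 (flagRank N) t
          (subst (_≤ suc t) (trans (flagRank-extend-0ᵛ a N)
            (cong (_+ flagRank N) (rowRank-row-≢0 (a ∷ 0ᵛ) (a≢0 ∘ proj₁ ∘ ∷-injective)))) fr≤)) , refl)

  card-diagonalStep : ∀ {t} → HasCardinality (FlagBall {n} (suc t)) j → HasCardinality (FlagBall {n} t) k →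
    HasCardinality (DiagonalStep {n} t) (j + p * k)
  card-diagonalStep card-j card-k = card-⊎
    (λ { (_ , _ , refl) (_ , (a≢0 , _) , eq) → a≢0 (sym (proj₁ (extend-injective eq))) })
    (card-image (extend 0# 0ᵛ) (λ eq → proj₂ (proj₂ (extend-injective eq))) card-j)
    (card-image extendDiagonal
      (λ eq → let (a≡ , _ , N≡) = extend-injective eq in cong₂ _,_ a≡ N≡)
      (card-× (card-≢ enumeration 0#) card-k))

  ball-empty : ∀ t → HasCardinality (FlagBall {0} t) 1
  ball-empty t = card-cong ((λ { refl → (λ ()) , z≤n }) , λ { {[]} _ → refl }) (card-singleton [])

  card-ball₀ : ∀ n → HasCardinality (FlagBall {n} 0) 1
  card-ball₀ n = card-cong
    ( (λ { refl → 0ᴹ-upperTriangular , ℕ.≤-reflexive (flagRank-0ᴹ n) })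
    , (λ {M} (M-UT , fr≤0) → flagRank-≤0⇒≡0ᴹ M M-UT fr≤0))
    (card-singleton 0ᴹ)

  -- A non-zero off-diagonal entry in the first row already costs 2, so only the diagonal step
  -- contributes.
  card-ball₁ : ∀ n → HasCardinality (FlagBall {n} 1) (1 + n * p)
  card-ball₁ zero    = ball-empty 1
  card-ball₁ (suc n) = subst (HasCardinality (FlagBall 1)) (regroup n p)
    (card-cong (diagonalStep⊆ball , ball⊆) (card-diagonalStep (card-ball₁ n) (card-ball₀ n)))
    where
    regroup : ∀ n p → 1 + n * p + p * 1 ≡ 1 + suc n * p
    regroup = ℕ-Solver.solve-∀
    ball⊆ : FlagBall 1 ⊆ DiagonalStep {n} 0
    ball⊆ {M} (M-UT , fr≤1) with upperTriangular⇒extend M M-UT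
    ... | a , v , N , N-UT , refl with ≡-dec _≟_ v 0ᵛ
    ...   | yes refl = ball⊆diagonalStep a N N-UT fr≤1
    ...   | no  v≢0  = contradiction (ℕ.≤-trans (flagRank-extend-≥2 a v N v≢0) fr≤1) λ { (s≤s ()) }

  leadingBlock : Carrier × Carrier × Carrier → Matrix (suc (suc n)) (suc (suc n))
  leadingBlock (a , c , b) = extend a (b ∷ 0ᵛ) (extend c 0ᵛ 0ᴹ)

  OffDiagonal : Pred (Matrix (suc (suc n)) (suc (suc n))) 0ℓ
  OffDiagonal = Image leadingBlock (λ (a , c , b) → U a × U c × b ≢ 0#)

  card-offDiagonal : HasCardinality (OffDiagonal {n}) (suc p * (suc p * p))
  card-offDiagonal = card-image leadingBlock
    (λ eq → let (a≡ , bv≡ , N≡) = extend-injective eq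
            in cong₂ _,_ a≡ (cong₂ _,_ (proj₁ (extend-injective N≡)) (proj₁ (∷-injective bv≡))))
    (card-× (card-↔ enumeration) (card-× (card-↔ enumeration) (card-≢ enumeration 0#)))

  offDiagonal⊆ball : OffDiagonal {n} ⊆ FlagBall 2
  offDiagonal⊆ball ((a , c , b) , (_ , _ , b≢0) , refl) =
    extend-upperTriangular a _ (extend-upperTriangular c 0ᵛ 0ᴹ-upperTriangular) ,
    flagRank-off-diagonal a b c b≢0

  -- Splits by whether the first row vanishes off the diagonal; if it does not, the weight bound
  -- forces a matrix in `OffDiagonal`.
  card-ball₂ : ∀ n → HasCardinality (FlagBall {suc n} 2) (ball₂ p n)
  -- Both balls of size 0 are singletons, which gives the base value 1 + p * 1.
  card-ball₂ zero = card-cong (diagonalStep⊆ball , ball⊆) (card-diagonalStep (ball-empty 2) (ball-empty 1))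
    where
    ball⊆ : FlagBall 2 ⊆ DiagonalStep {0} 1
    ball⊆ {M} (M-UT , fr≤2) with upperTriangular⇒extend M M-UT
    ... | a , [] , N , N-UT , refl = ball⊆diagonalStep a N N-UT fr≤2
  card-ball₂ (suc n) = card-cong
    ( (λ { (inj₁ M∈) → diagonalStep⊆ball M∈ ; (inj₂ M∈) → offDiagonal⊆ball M∈ })
    , ball⊆)
    (card-⊎ disjoint (card-diagonalStep (card-ball₂ n) (card-ball₁ (suc n))) card-offDiagonal)
    where
    disjoint : ∀ {M} → DiagonalStep {suc n} 1 M → ¬ OffDiagonal M
    disjoint (inj₁ (_ , _ , refl)) (_ , (_ , _ , b≢0) , eq) =
      b≢0 (sym (proj₁ (∷-injective (proj₁ (proj₂ (extend-injective eq))))))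
    disjoint (inj₂ (_ , _ , refl)) (_ , (_ , _ , b≢0) , eq) =
      b≢0 (sym (proj₁ (∷-injective (proj₁ (proj₂ (extend-injective eq))))))

    ball⊆ : ∀ {M} → FlagBall 2 M → DiagonalStep {suc n} 1 M ⊎ OffDiagonal M
    ball⊆ {M} (M-UT , fr≤2) with upperTriangular⇒extend M M-UT
    ... | a , b ∷ v , N , N-UT , refl with ≡-dec _≟_ (b ∷ v) 0ᵛ
    ...   | yes refl = inj₁ (ball⊆diagonalStep a N N-UT fr≤2)
    ...   | no  bv≢0 with upperTriangular⇒extend N N-UT
    ...     | c , w , L , L-UT , refl with flagRank-≤2⇒off-diagonal a b c v w L bv≢0 L-UT fr≤2
    ...       | refl , b≢0 , refl , refl = inj₂ ((a , c , b) , (_ , _ , b≢0) , refl)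

-- Linear codes of distance 5: codimension and perfection.

module Codes {p : ℕ} (1<q : 1 ℕ.< suc p) (F : FiniteField (suc p)) where
  open import Data.Nat using (_+_; _*_; _∸_; _^_; _≤_; _<_)
  open import Data.Vec using (Vec; []; _∷_; lookup)
  open FiniteField F using (Carrier; 0#; 1#; ring; enumeration)
  private module F = Ring ring
  open FlagRank F
  open Rank 1<q F
  open FlagRankWeight 1<q F
  open Balls 1<q F

  private module M {n : ℕ} = LeftModule (matrixSpace n n)
  open M using (_+ᴹ_; _*ₗ_)

  VanishAt : Fin n → Fin n → Pred (Matrix n n) 0ℓ
  VanishAt i j M = lookup (lookup M i) j ≡ 0#

  vanish-+ : ∀ i j (A B : Matrix n n) → VanishAt i j A → VanishAt i j B → VanishAt i j (A +ᴹ B)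
  vanish-+ i j A B A≡0 B≡0 = trans (cong (λ row → lookup row j) (lookup-zipWith _ i A B))
    (trans (lookup-zipWith F._+_ j (lookup A i) (lookup B i))
    (trans (cong₂ F._+_ A≡0 B≡0) (F.+-identityˡ 0#)))

  vanish-* : ∀ i j c (A : Matrix n n) → VanishAt i j A → VanishAt i j (c *ₗ A)
  vanish-* i j c A A≡0 = trans (cong (λ row → lookup row j) (lookup-map i _ A))
    (trans (lookup-map j (c F.*_) (lookup A i))
    (trans (cong (c F.*_) A≡0) (F.zeroʳ c)))

  -- A condition on columns passes entrywise to sums and multiples, and for k = 3 it bounds the
  -- weight.
  ColumnsVanish : ℕ → Pred (Matrix n n) 0ℓ
  ColumnsVanish k M = ∀ i j → k ≤ toℕ j → VanishAt i j M

  extend-columnsVanish : ∀ a (v : Vec Carrier n) {M} → (∀ j → k ≤ toℕ j → lookup v j ≡ 0#) →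
    ColumnsVanish k M → ColumnsVanish (suc k) (extend a v M)
  extend-columnsVanish a v     v≡0 M≡0 zero    (suc j) (s≤s k≤j) = v≡0 j k≤j
  extend-columnsVanish a v {M} v≡0 M≡0 (suc i) (suc j) (s≤s k≤j) =
    trans (cong (λ row → lookup row (suc j)) (lookup-map i (0# ∷_) M)) (M≡0 i j k≤j)

  suffix-vanish : (M : Matrix n n) → ColumnsVanish k M → ∀ i r c → k ≤ toℕ i + toℕ c →
    lookup (lookup M r) (cast (ℕ.m+[n∸m]≡n (toℕ≤n i)) (toℕ i ↑ʳ c)) ≡ 0#
  suffix-vanish {k = k} M M≡0 i r c k≤ = M≡0 r _ (subst (k ≤_)
    (sym (trans (toℕ-cast (ℕ.m+[n∸m]≡n (toℕ≤n i)) (toℕ i ↑ʳ c)) (toℕ-↑ʳ (toℕ i) c))) k≤)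

  -- The corners have ranks at most 1, 2, 1, 0, ...: the first two by their number of rows, the
  -- third because only its first column survives, the others because they are zero.
  flagRank-≤4 : (M : Matrix (3 + m) (3 + m)) → ColumnsVanish 3 M → flagRank M ≤ 4
  flagRank-≤4 {m} M M≡0 = ℕ.+-mono-≤ (rowRank≤rows (corner M zero))
    (ℕ.+-mono-≤ (rowRank≤rows (corner M (suc zero)))
    (ℕ.+-mono-≤
      (rowRank-≤ ((1# ∷ 0ᵛ) ∷ []) (corner M (suc (suc zero))) (All.tabulate⁺ λ r →
        let row = lookup M (inject≤ r (s≤s (s≤s (s≤s z≤n)))) in
        subst (Span (vectorSpace (suc m)) _)
          (cong (lookup row (suc (suc zero)) ∷_) (sym (tabulate-const λ c →
            suffix-vanish M M≡0 (suc (suc zero)) (inject≤ r (s≤s (s≤s (s≤s z≤n)))) (suc c)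
              (s≤s (s≤s (s≤s z≤n))))))
          (span-unit (lookup row (suc (suc zero))))))
      (sum-tabulate-zero {m} λ i → rowRank-zero (corner M (suc (suc (suc i)))) (All.tabulate⁺ λ r →
        tabulate-const λ c → suffix-vanish M M≡0 (suc (suc (suc i))) (inject≤ r (toℕ<n (suc (suc (suc i))))) c
          (s≤s (s≤s (s≤s z≤n)))))))

  -- The 6-dimensional space of upper triangular matrices supported on the
  -- leading 3 × 3 block.
  block : Vec Carrier 6 → Matrix (3 + m) (3 + m)
  block (a ∷ b ∷ c ∷ d ∷ e ∷ f ∷ []) =
    extend a (b ∷ c ∷ 0ᵛ) (extend d (e ∷ 0ᵛ) (extend f 0ᵛ 0ᴹ))

  block-injective : ∀ {x y} → block {m} x ≡ block y → x ≡ y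
  block-injective {x = _ ∷ _ ∷ _ ∷ _ ∷ _ ∷ _ ∷ []} {_ ∷ _ ∷ _ ∷ _ ∷ _ ∷ _ ∷ []} eq
    with extend-injective eq
  ... | refl , row₁ , eq₁ with extend-injective eq₁ | ∷-injective row₁
  ...   | refl , row₂ , eq₂ | refl , row₃ with extend-injective eq₂ | ∷-injective row₂ | ∷-injective row₃
  ...     | refl , _ | refl , _ | refl , _ = refl

  block-upperTriangular : ∀ x → UpperTriangular (block {m} x)
  block-upperTriangular (a ∷ b ∷ c ∷ d ∷ e ∷ f ∷ []) =
    extend-upperTriangular a _ (extend-upperTriangular d _ (extend-upperTriangular f _ 0ᴹ-upperTriangular))

  block-columnsVanish : ∀ x → ColumnsVanish 3 (block {m} x)
  block-columnsVanish (a ∷ b ∷ c ∷ d ∷ e ∷ f ∷ []) =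
    extend-columnsVanish a _ (λ { (suc (suc j)) _ → lookup-replicate j 0# ; zero () ; (suc zero) (s≤s ()) })
    (extend-columnsVanish d _ (λ { (suc j) _ → lookup-replicate j 0# ; zero () })
    (extend-columnsVanish f _ (λ j _ → lookup-replicate j 0#)
    (λ i j _ → trans (cong (λ row → lookup row j) (lookup-replicate i 0ᵛ)) (lookup-replicate j 0#))))

  module _ {C : Pred (Matrix n n) ℓ} (C-linear : IsLinearCode C) where
    open IsLinearCode C-linear

    combination∈ : {vs : Vec (Matrix n n) k} → All C vs → ∀ cs → C (combination (matrixSpace n n) cs vs)
    combination∈ []         []       = 0ᴹ∈
    combination∈ (v∈ ∷ vs∈) (c ∷ cs) = +ᴹ-closed (*ₗ-closed c v∈) (combination∈ vs∈ cs)

    card-code : HasDimension (matrixSpace n n) C k → HasCardinality C (suc p ^ k)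
    card-code {k} (vs , vs∈ , independent , spans) = card-cong
      ((λ { (cs , _ , refl) → combination∈ vs∈ cs }) , λ M∈ → let (cs , eq) = spans M∈ in cs , _ , eq)
      (card-image (λ cs → combination (matrixSpace n n) cs vs)
        (combination-injective (matrixSpace n n) independent) (card-vectors k))

  -- `IsPerfect` carries its own distance; this identifies it with the given one.
  minimumDistance-unique : ∀ {C : Pred (Matrix n n) ℓ} {δ ε} →
    HasMinimumDistance C δ → HasMinimumDistance C ε → δ ≡ ε
  minimumDistance-unique ((M , M∈ , M≢0 , refl) , min) ((N , N∈ , N≢0 , refl) , min′) =
    ℕ.≤-antisym (min N N∈ N≢0) (min′ M M∈ M≢0)

  light⇒0 : {C : Pred (Matrix n n) ℓ} → HasMinimumDistance C 5 →
    ∀ {M} → C M → flagRank M ≤ 4 → M ≡ 0ᴹ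
  light⇒0 (_ , min) {M} M∈ light with ≡-dec (≡-dec _≟_) M 0ᴹ
  ... | yes M≡0 = M≡0
  ... | no  M≢0 = contradiction light (ℕ.<⇒≱ (subst (5 ≤_) (fr≡flagRank M) (min M M∈ M≢0)))

  heavy-codeword : {C : Pred (Matrix n n) ℓ} → HasMinimumDistance C 5 → ∃[ M ] 5 ≤ flagRank {n} M
  heavy-codeword ((M , _ , _ , fr≡5) , _) = M , ℕ.≤-reflexive (trans (sym fr≡5) (fr≡flagRank M))

  module _ {C : Pred (Matrix (3 + m) (3 + m)) ℓ} (C-linear : IsLinearCode C)
    (C-distance : HasMinimumDistance C 5) where
    open IsLinearCode C-linear
    private V = matrixSpace (3 + m) (3 + m)

    -- The code meets the block space only in 0, so the q ^ (k + 6) sums of a codeword and a block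
    -- are distinct upper triangular matrices.
    dimension+6≤ : HasDimension V C k → k + 6 ≤ triangle (3 + m)
    dimension+6≤ {k} (vs , vs∈ , independent , spans) = ^-cancelʳ-≤ 1<q
      (subst (_≤ suc p ^ triangle (3 + m)) (sym (ℕ.^-distribˡ-+-* (suc p) k 6))
        (card-mono image⊆
          (card-image translate translate-injective (card-× (card-vectors k) (card-vectors 6)))
          (card-upperTriangular (3 + m))))
      where
      comb : Vec Carrier k → Matrix (3 + m) (3 + m)
      comb cs = combination V cs vs

      translate : Vec Carrier k × Vec Carrier 6 → Matrix (3 + m) (3 + m)
      translate (cs , x) = comb cs +ᴹ block x

      image⊆ : Image translate (λ (cs , x) → U cs × U x) ⊆ UpperTriangular
      image⊆ ((cs , x) , _ , refl) i j j<i = vanish-+ i j (comb cs) (block x)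
        (upperTriangular (combination∈ C-linear vs∈ cs) i j j<i) (block-upperTriangular x i j j<i)

      translate-injective : ∀ {s t} → translate s ≡ translate t → s ≡ t
      translate-injective {cs , x} {ds , y} eq = cong₂ _,_
        (combination-injective V independent {cs} {ds} (difference-zero V {comb cs} {comb ds} D≡0))
        (sym (block-injective (difference-zero V {block y} {block x} (trans (sym swap) D≡0))))
        where
        swap : comb cs +ᴹ (F.- 1#) *ₗ comb ds ≡ block y +ᴹ (F.- 1#) *ₗ block x
        swap = difference-swap V {comb cs} {comb ds} {block x} {block y} eq

        -- This difference is a codeword and, by `swap`, also a difference of blocks, hence of
        -- weight at most 4.
        D≡0 : comb cs +ᴹ (F.- 1#) *ₗ comb ds ≡ 0ᴹ
        D≡0 = light⇒0 C-distance
          (+ᴹ-closed (combination∈ C-linear vs∈ cs) (*ₗ-closed (F.- 1#) (combination∈ C-linear vs∈ ds)))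
          (flagRank-≤4 (comb cs +ᴹ (F.- 1#) *ₗ comb ds) (subst (ColumnsVanish 3) (sym swap) λ i j 3≤j →
            vanish-+ i j (block y) ((F.- 1#) *ₗ block x)
            (block-columnsVanish y i j 3≤j)
            (vanish-* i j (F.- 1#) (block x) (block-columnsVanish x i j 3≤j))))

  -- Sizes 0, 1 and 2 are impossible: the row counts of the corners bound the weight by 0, 1 and 3,
  -- while some codeword has weight 5.
  codimension>5 : {C : Pred (Matrix n n) ℓ} → ∀ {α} → IsLinearCode C → HasMinimumDistance C 5 →
    HasCodimension C α → 5 < α
  codimension>5 {zero} _ C-distance _ with heavy-codeword C-distance
  ... | _ , ()
  codimension>5 {suc zero} _ C-distance _ with heavy-codeword C-distance
  ... | M , 5≤ = contradiction {A = 5 ≤ 1}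
    (ℕ.≤-trans 5≤ (ℕ.+-mono-≤ (rowRank≤rows (corner M zero)) z≤n))
    λ { (s≤s ()) }
  codimension>5 {suc (suc zero)} _ C-distance _ with heavy-codeword C-distance
  ... | M , 5≤ = contradiction {A = 5 ≤ 3}
    (ℕ.≤-trans 5≤ (ℕ.+-mono-≤ (rowRank≤rows (corner M zero))
      (ℕ.+-mono-≤ (rowRank≤rows (corner M (suc zero))) z≤n)))
    λ { (s≤s (s≤s (s≤s ()))) }
  codimension>5 {suc (suc (suc m))} {α = α} C-linear C-distance (k , C-dimension , k+α≡) =
    ℕ.+-cancelˡ-≤ k 6 α (subst (k + 6 ≤_) (trans (triangle≡ (3 + m)) (sym k+α≡))
      (dimension+6≤ C-linear C-distance C-dimension))

  -- The code has q ^ k elements, so perfection reads q ^ k * b = q ^ (k + α), and q ^ k cancels.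
  perfect⇔ : {C : Pred (Matrix (suc n) (suc n)) ℓ} → ∀ {α} → IsLinearCode C → HasMinimumDistance C 5 →
    HasCodimension C α → IsPerfect C ⇔ ball₂ p n ≡ suc p ^ α
  perfect⇔ {n} {C = C} {α} C-linear C-distance (k , C-dimension , k+α≡) = mk⇔ to from
    where
    q = suc p

    q^[k+α]≡ : q ^ k * q ^ α ≡ q ^ (suc n * (suc n + 1) ℕ./ 2)
    q^[k+α]≡ = trans (sym (ℕ.^-distribˡ-+-* q k α)) (cong (q ^_) k+α≡)

    card-ball : HasCardinality (Ball {suc n} 2) (ball₂ p n)
    card-ball = card-cong
      ( (λ {M} (M-UT , fr≤2) → M-UT , subst (_≤ 2) (sym (fr≡flagRank M)) fr≤2)
      , (λ {M} (M-UT , fr≤2) → M-UT , subst (_≤ 2) (fr≡flagRank M) fr≤2))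
      (card-ball₂ n)

    -- The distance enters through an equation, so that matching on it turns the radius (δ - 1) / 2
    -- into 2.
    sizes : ∀ {δ c b} → δ ≡ 5 → HasCardinality C c → HasCardinality (Ball {suc n} ((δ ∸ 1) ℕ./ 2)) b →
      c ≡ q ^ k × b ≡ ball₂ p n
    sizes refl card-C card-b =
      card-unique {P = C} card-C (card-code C-linear C-dimension) ,
      card-unique {P = Ball 2} card-b card-ball

    to : IsPerfect C → ball₂ p n ≡ q ^ α
    to (δ , C-distance′ , c , b , card-C , card-b , eq) =
      let (c≡ , b≡) = sizes (minimumDistance-unique {C = C} C-distance′ C-distance) card-C card-b
      in ℕ.*-cancelˡ-≡ (ball₂ p n) (q ^ α) (q ^ k) {{ℕ.m^n≢0 q k}}
           (trans (cong₂ _*_ (sym c≡) (sym b≡)) (trans eq (sym q^[k+α]≡)))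

    from : ball₂ p n ≡ q ^ α → IsPerfect C
    from eq = 5 , C-distance , q ^ k , ball₂ p n , card-code C-linear C-dimension , card-ball ,
      trans (cong (q ^ k *_) eq) q^[k+α]≡

-- From the real square-root formula to an integer equation.

module QuadraticRoot where
  open import Data.Integer using (+_)
  open import Data.Rational using (ℚ; 0ℚ; _<_; _≤_; _<?_)
  import Data.Rational as ℚ
  import Data.Rational.Properties as ℚ
  import Data.Rational.Unnormalised as ℚᵘ
  import Data.Rational.Unnormalised.Properties as ℚᵘ
  open Real using (square-mono-<; square-mono-≤; q-c+c≡q)

  -- Equality of unnormalised fractions is cross-multiplication, where the denominators 1 cancel.
  fromℤ-injective : ∀ {i j} → fromℤ i ≡ fromℤ j → i ≡ j
  fromℤ-injective {i} {j} eq with ℚ.fromℚᵘ-injective {ℚᵘ.mkℚᵘ i 0} {ℚᵘ.mkℚᵘ j 0} eq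
  ... | ℚᵘ.*≡* i≡j = ℤ.*-cancelʳ-≡ i j (+ 1) i≡j

  toℚᵘ-fromℤ : ∀ i → ℚ.toℚᵘ (fromℤ i) ℚᵘ.≃ ℚᵘ.mkℚᵘ i 0
  toℚᵘ-fromℤ i = ℚ.toℚᵘ-fromℚᵘ (ℚᵘ.mkℚᵘ i 0)

  fromℤ-+ : ∀ i j → fromℤ (i ℤ.+ j) ≡ fromℤ i ℚ.+ fromℤ j
  fromℤ-+ i j = ℚ.toℚᵘ-injective (begin
    ℚ.toℚᵘ (fromℤ (i ℤ.+ j))                       ≈⟨ toℚᵘ-fromℤ (i ℤ.+ j) ⟩
    ℚᵘ.mkℚᵘ (i ℤ.+ j) 0                            ≈⟨ ℚᵘ.*≡* (cong (ℤ._* + 1) (sym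
                                                          (cong₂ ℤ._+_ (ℤ.*-identityʳ i) (ℤ.*-identityʳ j)))) ⟩
    ℚᵘ.mkℚᵘ i 0 ℚᵘ.+ ℚᵘ.mkℚᵘ j 0                   ≈⟨ ℚᵘ.+-cong (toℚᵘ-fromℤ i) (toℚᵘ-fromℤ j) ⟨
    ℚ.toℚᵘ (fromℤ i) ℚᵘ.+ ℚ.toℚᵘ (fromℤ j)         ≈⟨ ℚ.toℚᵘ-homo-+ (fromℤ i) (fromℤ j) ⟨
    ℚ.toℚᵘ (fromℤ i ℚ.+ fromℤ j)                   ∎)
    where open ℚᵘ.≃-Reasoning

  fromℤ-* : ∀ i j → fromℤ (i ℤ.* j) ≡ fromℤ i ℚ.* fromℤ j
  fromℤ-* i j = ℚ.toℚᵘ-injective (begin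
    ℚ.toℚᵘ (fromℤ (i ℤ.* j))                       ≈⟨ toℚᵘ-fromℤ (i ℤ.* j) ⟩
    ℚᵘ.mkℚᵘ i 0 ℚᵘ.* ℚᵘ.mkℚᵘ j 0                   ≈⟨ ℚᵘ.*-cong (toℚᵘ-fromℤ i) (toℚᵘ-fromℤ j) ⟨
    ℚ.toℚᵘ (fromℤ i) ℚᵘ.* ℚ.toℚᵘ (fromℤ j)         ≈⟨ ℚ.toℚᵘ-homo-* (fromℤ i) (fromℤ j) ⟨
    ℚ.toℚᵘ (fromℤ i ℚ.* fromℤ j)                   ∎)
    where open ℚᵘ.≃-Reasoning

  fromℤ-neg : ∀ i → fromℤ (ℤ.- i) ≡ ℚ.- fromℤ i
  fromℤ-neg i = ℚ.toℚᵘ-injective (begin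
    ℚ.toℚᵘ (fromℤ (ℤ.- i))       ≈⟨ toℚᵘ-fromℤ (ℤ.- i) ⟩
    ℚᵘ.- ℚᵘ.mkℚᵘ i 0             ≈⟨ ℚᵘ.-‿cong (toℚᵘ-fromℤ i) ⟨
    ℚᵘ.- ℚ.toℚᵘ (fromℤ i)        ≈⟨ ℚ.toℚᵘ-homo‿- (fromℤ i) ⟨
    ℚ.toℚᵘ (ℚ.- fromℤ i)         ∎)
    where open ℚᵘ.≃-Reasoning

  fromℤ-mono-< : ∀ {i j} → i ℤ.< j → fromℤ i < fromℤ j
  fromℤ-mono-< {i} {j} i<j = ℚ.toℚᵘ-cancel-<
    (ℚᵘ.<-respˡ-≃ (ℚᵘ.≃-sym (toℚᵘ-fromℤ i)) (ℚᵘ.<-respʳ-≃ (ℚᵘ.≃-sym (toℚᵘ-fromℤ j))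
      (ℚᵘ.*<* (subst₂ ℤ._<_ (sym (ℤ.*-identityʳ i)) (sym (ℤ.*-identityʳ j)) i<j))))

  square-cancel-< : ∀ {p r} → 0ℚ ≤ r → p ℚ.* p < r ℚ.* r → p < r
  square-cancel-< {p} {r} 0≤r p²<r² with p <? r
  ... | yes p<r = p<r
  ... | no  p≮r = contradiction
        (ℚ.<-≤-trans p²<r² (square-mono-≤ 0≤r (ℚ.≮⇒≥ p≮r))) (ℚ.<-irrefl refl)

  -- s is the value that √ d must take for the equality to hold.
  module _ (x c d e s : ℚ) .{{_ : ℚ.Positive e}} (0<s : 0ℚ < s) (xe-c≡s : x ℚ.* e ℚ.- c ≡ s) where

    private
      shift-< : ∀ {r t} → r < t → r ℚ.* e ℚ.- c < t ℚ.* e ℚ.- c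
      shift-< r<t = ℚ.+-monoˡ-< (ℚ.- c) (ℚ.*-monoˡ-<-pos e r<t)

      shift-cancel-< : ∀ {r t} → r ℚ.* e ℚ.- c < t ℚ.* e ℚ.- c → r < t
      shift-cancel-< {r} {t} lt = ℚ.*-cancelʳ-<-nonNeg e {{ℚ.pos⇒nonNeg e}}
        (subst₂ _<_ (q-c+c≡q (r ℚ.* e) c) (q-c+c≡q (t ℚ.* e) c) (ℚ.+-monoˡ-< c lt))

    -- The increasing map r ↦ r e - c sends x to s, so comparing r with x amounts to comparing its
    -- image with s; for s > 0 the cut of √ d does this through squares.
    ≈ℝ-quadratic-root : fromℚ x ≈ℝ (c +ℝ √ d) ÷ℝ e ⇔ s ℚ.* s ≡ d
    ≈ℝ-quadratic-root = mk⇔ to from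
      where
      to : fromℚ x ≈ℝ (c +ℝ √ d) ÷ℝ e → s ℚ.* s ≡ d
      -- The inclusions are tested at x itself: either strict inequality between s² and d would give
      -- x < x.
      to ((_ , lower⊆) , (_ , upper⊆)) with ℚ.<-cmp (s ℚ.* s) d
      ... | tri< s²<d _ _ = contradiction
              (lower⊆ {x} (inj₂ (subst (λ t → t ℚ.* t < d) (sym xe-c≡s) s²<d))) (ℚ.<-irrefl refl)
      ... | tri≈ _ s²≡d _ = s²≡d
      ... | tri> _ _ d<s² = contradiction
              (upper⊆ {x} (subst (λ t → 0ℚ < t × d < t ℚ.* t) (sym xe-c≡s) (0<s , d<s²))) (ℚ.<-irrefl refl)

      from : s ℚ.* s ≡ d → fromℚ x ≈ℝ (c +ℝ √ d) ÷ℝ e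
      from refl = ((λ r<x → lower (subst (_ <_) xe-c≡s (shift-< r<x))) , lower⁻)
                , ((λ x<r → upper (subst (_< _) xe-c≡s (shift-< x<r))) , upper⁻)
        where
        lower : ∀ {t} → t < s → t < 0ℚ ⊎ t ℚ.* t < s ℚ.* s
        lower {t} t<s with t <? 0ℚ
        ... | yes t<0 = inj₁ t<0
        ... | no  t≮0 = inj₂ (square-mono-< (ℚ.≮⇒≥ t≮0) t<s)

        lower⁻ : ∀ {r} → r ℚ.* e ℚ.- c < 0ℚ ⊎ (r ℚ.* e ℚ.- c) ℚ.* (r ℚ.* e ℚ.- c) < s ℚ.* s → r < x
        lower⁻ (inj₁ t<0)   = shift-cancel-< (subst (_ <_) (sym xe-c≡s) (ℚ.<-trans t<0 0<s))
        lower⁻ (inj₂ t²<s²) = shift-cancel-< (subst (_ <_) (sym xe-c≡s)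
          (square-cancel-< (ℚ.<⇒≤ 0<s) t²<s²))

        upper : ∀ {t} → s < t → 0ℚ < t × s ℚ.* s < t ℚ.* t
        upper s<t = ℚ.<-trans 0<s s<t , square-mono-< (ℚ.<⇒≤ 0<s) s<t

        upper⁻ : ∀ {r} → 0ℚ < r ℚ.* e ℚ.- c × s ℚ.* s < (r ℚ.* e ℚ.- c) ℚ.* (r ℚ.* e ℚ.- c) → x < r
        upper⁻ (0<t , s²<t²) = shift-cancel-< (subst (_< _) (sym xe-c≡s)
          (square-cancel-< (ℚ.<⇒≤ 0<t) s²<t²))

  ≈ℝ-quadratic-rootℤ : ∀ x c d e s .{{_ : ℚ.Positive (fromℤ e)}} → + 0 ℤ.< s → x ℤ.* e ℤ.- c ≡ s →
    fromℚ (fromℤ x) ≈ℝ (fromℤ c +ℝ √ fromℤ d) ÷ℝ fromℤ e ⇔ s ℤ.* s ≡ d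
  ≈ℝ-quadratic-rootℤ x c d e s 0<s xe-c≡s = mk⇔
    (λ eq → fromℤ-injective (trans (fromℤ-* s s) (E.to eq)))
    (λ eq → E.from (trans (sym (fromℤ-* s s)) (cong fromℤ eq)))
    where
    module E = Equivalence (≈ℝ-quadratic-root (fromℤ x) (fromℤ c) (fromℤ d) (fromℤ e) (fromℤ s)
      (fromℤ-mono-< 0<s)
      (trans (sym (trans (fromℤ-+ (x ℤ.* e) (ℤ.- c)) (cong₂ ℚ._+_ (fromℤ-* x e) (fromℤ-neg c))))
             (cong fromℤ xe-c≡s)))

open QuadraticRoot

-- The quadratic equation over the integers, and the theorem.

open import Data.Integer using (+_; -_; _+_; _-_; _*_; _^_)
open import Data.Nat using (_≤_; _<_; _>_)

pos-^ : ∀ m k → + (m ℕ.^ k) ≡ (+ m) ^ k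
pos-^ m zero    = refl
pos-^ m (suc k) = trans (ℤ.pos-* m (m ℕ.^ k)) (cong (+ m *_) (pos-^ m k))

-- With q = p + 1, the number 2 q² - q + 3 becomes 2 p² + 3 p + 4, the subtraction-free form in
-- `root`.
pos-root : ∀ n p → let Q = + suc p in
  + n * (+ 2 * (Q - + 1)) - (- (+ 2 * Q ^ 2 - Q + + 3)) ≡ + root n p
pos-root n p = trans (ring (+ n) (+ p)) (sym (cong₂ _+_
  (trans (ℤ.pos-* n (2 ℕ.* p)) (cong (+ n *_) (ℤ.pos-* 2 p)))
  (cong₂ _+_ (trans (ℤ.pos-* 2 (p ℕ.* p)) (cong (+ 2 *_) (ℤ.pos-* p p)))
             (cong (_+ + 4) (ℤ.pos-* 3 p)))))
  where
  ring : ∀ N P →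
    N * (+ 2 * ((+ 1 + P) - + 1)) - (- (+ 2 * ((+ 1 + P) * ((+ 1 + P) * + 1)) - (+ 1 + P) + + 3)) ≡
    N * (+ 2 * P) + (+ 2 * (P * P) + (+ 3 * P + + 4))
  ring = ℤ-Solver.solve-∀

pos-offset : ∀ q → + offset q ≡ + 2 * (+ q) ^ 2 + + q + + 1
pos-offset q = trans
  (cong (_+ (+ q + + 1)) (trans (ℤ.pos-* 2 (q ℕ.* q)) (cong (+ 2 *_) (ℤ.pos-* q q))))
  (ring (+ q))
  where
  ring : ∀ Q → + 2 * (Q * Q) + (Q + + 1) ≡ + 2 * (Q * (Q * + 1)) + Q + + 1
  ring = ℤ-Solver.solve-∀

-- Adding 8 q to both sides removes the subtraction, and the equation descends to the naturals.
discriminant⇔ : ∀ r y q a →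
  + r * + r ≡ (+ y) ^ 2 + + 8 * (+ a - + q) ⇔ r ℕ.* r ℕ.+ 8 ℕ.* q ≡ y ℕ.* y ℕ.+ 8 ℕ.* a
discriminant⇔ r y q a = mk⇔
  (λ eq → ℤ.+-injective (trans (pos-square r q) (trans
    (cong (_+ + 8 * + q) eq) (trans (ring (+ y) (+ a) (+ q)) (sym (pos-square y a))))))
  (λ eq → ℤ-Group.∙-cancelʳ (+ 8 * + q) (+ r * + r) _ (trans (sym (pos-square r q))
    (trans (cong +_ eq) (trans (pos-square y a) (sym (ring (+ y) (+ a) (+ q)))))))
  where
  module ℤ-Group = AbelianGroupProperties ℤ.+-0-abelianGroup
  pos-square : ∀ x z → + (x ℕ.* x ℕ.+ 8 ℕ.* z) ≡ + x * + x + + 8 * + z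
  pos-square x z = cong₂ _+_ (ℤ.pos-* x x) (ℤ.pos-* 8 z)
  ring : ∀ Y A Q → Y * (Y * + 1) + + 8 * (A - Q) + + 8 * Q ≡ Y * Y + + 8 * A
  ring = ℤ-Solver.solve-∀

-- After `root²`, the square of the offset and the factor 8 cancel.
ball₂⇔ : ∀ p n α → let Q = + suc p in
  + root (suc n) p * + root (suc n) p ≡ (+ 2 * Q ^ 2 + Q + + 1) ^ 2 + + 8 * (Q ^ α - Q)
  ⇔ ball₂ p n ≡ suc p ℕ.^ α
ball₂⇔ p n α = mk⇔
  (λ eq → ℕ.*-cancelˡ-≡ (ball₂ p n) (suc p ℕ.^ α) 8 (ℕ.+-cancelˡ-≡ (y ℕ.* y) _ _
    (trans (sym (root² p n)) (E.to (trans eq (sym rhs≡))))))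
  (λ eq → trans (E.from (trans (root² p n) (cong (λ b → y ℕ.* y ℕ.+ 8 ℕ.* b) eq))) rhs≡)
  where
  y = offset (suc p)
  module E = Equivalence (discriminant⇔ (root (suc n) p) y (suc p) (suc p ℕ.^ α))
  rhs≡ : (+ y) ^ 2 + + 8 * (+ (suc p ℕ.^ α) - + suc p) ≡
    (+ 2 * (+ suc p) ^ 2 + + suc p + + 1) ^ 2 + + 8 * ((+ suc p) ^ α - + suc p)
  rhs≡ = cong₂ (λ s t → s ^ 2 + + 8 * (t - + suc p)) (pos-offset (suc p)) (pos-^ (suc p) α)

primePower>1 : ∀ {q} → IsPrimePower q → 1 < q
primePower>1 (p , k , p-prime , 1≤k , refl) = ℕ.≤-trans
  (ℕ.nonTrivial⇒n>1 p {{prime⇒nonTrivial p-prime}})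
  (subst (ℕ._≤ p ℕ.^ k) (ℕ.*-identityʳ p) (ℕ.^-monoʳ-≤ p {{prime⇒nonZero p-prime}} 1≤k))

-- The constant term 4 suffices. Positivity makes s² = d mean s = √ d and excludes the other root.
root-positive : ∀ n p → + 0 ℤ.< + root n p
root-positive n p = ℤ.+<+ (ℕ.≤-trans (s≤s z≤n) (ℕ.≤-trans (ℕ.m≤n+m 4 (3 ℕ.* p))
  (ℕ.≤-trans (ℕ.m≤n+m _ (2 ℕ.* (p ℕ.* p))) (ℕ.m≤n+m _ (n ℕ.* (2 ℕ.* p))))))

theorem5p9 :
  ∀ {ℓ} (n q α : ℕ) → 1 ≤ n → (q-primePower : IsPrimePower q) → (F : FiniteField q) →
  let open FlagRank F
      Q = + q
  in (C : Pred (Matrix n n) ℓ) → IsLinearCode C → HasMinimumDistance C 5 → HasCodimension C α →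
     (IsPerfect C ⇔
       fromℚ (fromℤ (+ n)) ≈ℝ
         ((fromℤ (- (+ 2 * Q ^ 2 - Q + + 3))
             +ℝ √ fromℤ ((+ 2 * Q ^ 2 + Q + + 1) ^ 2 + + 8 * (Q ^ α - Q)))
           ÷ℝ fromℤ (+ 2 * (Q - + 1))) {{2[q-1]-positive q-primePower}})
     × α > 5
theorem5p9 n zero α _ q-primePower _ _ _ _ _ with primePower>1 q-primePower
... | ()
theorem5p9 (suc n) (suc p) α _ q-primePower F C C-linear C-distance C-codimension =
  ⇔.trans (perfect⇔ C-linear C-distance C-codimension)
    (⇔.trans (⇔.sym (ball₂⇔ p n α))
      (⇔.sym (≈ℝ-quadratic-rootℤ (+ suc n) (- (+ 2 * Q ^ 2 - Q + + 3))
        ((+ 2 * Q ^ 2 + Q + + 1) ^ 2 + + 8 * (Q ^ α - Q)) (+ 2 * (Q - + 1)) (+ root (suc n) p)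
        {{2[q-1]-positive q-primePower}} (root-positive (suc n) p) (pos-root (suc n) p)))) ,
  codimension>5 C-linear C-distance C-codimension
  where
  open Codes (primePower>1 q-primePower) F
  Q = + suc p
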